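{- Let $\Theta$ be such that $\textsf{SFF}(\Theta)$. There is a functional $G:\mathbb{N}^{\mathbb{N}}\to\mathbb{N}$ computable in $\exists^2$ such that $\Theta(G)$ is not hyperarithmetical.
   Context: The metatheory is $\textsf{ZFC}$ and functionals live in the full (set-theoretic) type structure over $\mathbb{N}$. "Computable" (in given functionals) means Kleene computable via the schemes S1–S9. For $f\in\mathbb{N}^{\mathbb{N}}$, $\overline{f}N=\langle f(0),\dots,f(N-1)\rangle$; for a finite sequence $\sigma$, $f\in[\sigma]$ means $f$ extends $\sigma$. A functional $\Theta$ of type $2\to1^*$ assigns to every $G:\mathbb{N}^{\mathbb{N}}\to\mathbb{N}$ a finite sequence $\Theta(G)=\langle f_0,\dots,f_k\rangle$ of elements of $\mathbb{N}^{\mathbb{N}}$. $\textsf{SFF}(\Theta)$ ("$\Theta$ is a special fan functional") is the statement: for all $G:\mathbb{N}^{\mathbb{N}}\to\mathbb{N}$ and all $f\in2^{\mathbb{N}}$ there is an entry $g$ of $\Theta(G)$ with $f\in[\overline{g}G(g)]$. $\exists^2:\mathbb{N}^{\mathbb{N}}\to\{0,1\}$ is the functional with $\exists^2(f)=0$ if and only if $(\exists n)(f(n)=0)$. A function $f:\mathbb{N}\to\mathbb{N}$ is hyperarithmetical if its graph is (lightface) $\Delta^1_1$ (equivalently $f$ is computable in $\exists^2$); a finite sequence of functions is hyperarithmetical if all its entries are. -}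

module Defs where

open import Data.Fin using (Fin)
open import Data.List using (List; []; _∷_; _++_; length; applyUpTo)
open import Data.List.Relation.Unary.All using (All)
open import Data.List.Relation.Unary.Any using (Any)
open import Data.Nat using (ℕ; zero; suc; _+_; _*_; _^_; _<_)
open import Data.Product using (Σ; ∃; _×_; _,_)
open import Data.Sum using (_⊎_)
open import Data.Vec using (Vec; []; _∷_; lookup)
open import Function.Bundles using (_⇔_)
open import Level using (0ℓ)
open import Relation.Binary.PropositionalEquality using (_≡_)
open import Relation.Nullary using (¬_)
open import Relation.Unary using (Pred)

-- The pure types over ℕ.  Under excluded middle and function extensionality
-- (hypotheses of the theorem) these are the full set-theoretic ones.

Tp : ℕ → Set
Tp zero    = ℕ
Tp (suc k) = Tp k → ℕ

_⇂_ : Tp 1 → ℕ → List ℕ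
f ⇂ N = applyUpTo f N

_∈[_] : Tp 1 → List ℕ → Set
f ∈[ σ ] = f ⇂ length σ ≡ σ

_∈2^ℕ : Tp 1 → Set
f ∈2^ℕ = ∀ n → f n < 2

SFF : (Tp 2 → List (Tp 1)) → Set
SFF Θ = ∀ (G : Tp 2) (f : Tp 1) → f ∈2^ℕ → Any (λ g → f ∈[ g ⇂ G g ]) (Θ G)

Is∃² : Tp 2 → Set
Is∃² E = ∀ f → E f < 2 × (E f ≡ 0 ⇔ ∃ λ n → f n ≡ 0)

------------------------------------------------------------------------
-- Kleene computability, S1–S9

-- A bijective coding of finite sequences.  It is opaque only to stop the
-- type checker from evaluating concrete indices to (enormous) numerals.

opaque
  ⟨_⟩ : List ℕ → ℕ
  ⟨ [] ⟩     = 0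
  ⟨ x ∷ xs ⟩ = 2 ^ x * suc (2 * ⟨ xs ⟩)

Arg : Set
Arg = Σ ℕ Tp

-- ⟪ e ⟫⟨ as ⟩≃ n : the computation with index e on arguments as terminates
-- with value n.  Indices do not record the types of the arguments; an index
-- applied to arguments of the wrong shape simply has no value.  S6 moves the
-- argument at position length bs to the front; such moves generate all
-- permutations.  In S8 the inner computation must be total in η.

data ⟪_⟫⟨_⟩≃_ : ℕ → List Arg → ℕ → Set where

  S1 : ∀ {x as} → ⟪ ⟨ 1 ∷ [] ⟩ ⟫⟨ (0 , x) ∷ as ⟩≃ suc x

  S2 : ∀ {q as} → ⟪ ⟨ 2 ∷ q ∷ [] ⟩ ⟫⟨ as ⟩≃ q

  S3 : ∀ {x as} → ⟪ ⟨ 3 ∷ [] ⟩ ⟫⟨ (0 , x) ∷ as ⟩≃ x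

  S4 : ∀ {e d as m n} →
       ⟪ d ⟫⟨ as ⟩≃ m →
       ⟪ e ⟫⟨ (0 , m) ∷ as ⟩≃ n →
       ⟪ ⟨ 4 ∷ e ∷ d ∷ [] ⟩ ⟫⟨ as ⟩≃ n

  S5-zero : ∀ {e d as n} →
       ⟪ e ⟫⟨ as ⟩≃ n →
       ⟪ ⟨ 5 ∷ e ∷ d ∷ [] ⟩ ⟫⟨ (0 , zero) ∷ as ⟩≃ n

  S5-suc : ∀ {e d x as m n} →
       ⟪ ⟨ 5 ∷ e ∷ d ∷ [] ⟩ ⟫⟨ (0 , x) ∷ as ⟩≃ m →
       ⟪ d ⟫⟨ (0 , x) ∷ (0 , m) ∷ as ⟩≃ n →
       ⟪ ⟨ 5 ∷ e ∷ d ∷ [] ⟩ ⟫⟨ (0 , suc x) ∷ as ⟩≃ n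

  S6 : ∀ {d} bs {a} cs {n} →
       ⟪ d ⟫⟨ a ∷ bs ++ cs ⟩≃ n →
       ⟪ ⟨ 6 ∷ length bs ∷ d ∷ [] ⟩ ⟫⟨ bs ++ a ∷ cs ⟩≃ n

  S7 : ∀ {f x as} → ⟪ ⟨ 7 ∷ [] ⟩ ⟫⟨ (1 , f) ∷ (0 , x) ∷ as ⟩≃ f x

  S8 : ∀ {d k as} {ξ : Tp (2 + k)} {F : Tp (1 + k)} →
       (∀ (η : Tp k) → ⟪ d ⟫⟨ (k , η) ∷ (2 + k , ξ) ∷ as ⟩≃ F η) →
       ⟪ ⟨ 8 ∷ d ∷ [] ⟩ ⟫⟨ (2 + k , ξ) ∷ as ⟩≃ ξ F

  S9 : ∀ {x} bs cs {n} →
       ⟪ x ⟫⟨ bs ⟩≃ n →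
       ⟪ ⟨ 9 ∷ length bs ∷ [] ⟩ ⟫⟨ (0 , x) ∷ bs ++ cs ⟩≃ n

_ComputableIn_ : Tp 2 → Tp 2 → Set
G ComputableIn E = ∃ λ e → ∀ (f : Tp 1) → ⟪ e ⟫⟨ (1 , f) ∷ (2 , E) ∷ [] ⟩≃ G f

------------------------------------------------------------------------
-- The lightface analytical classes

-- Arithmetical formulas of second-order arithmetic, with k free function
-- variables and n free number variables (de Bruijn indices).

data Term (k n : ℕ) : Set where
  var       : Fin n → Term k n
  app       : Fin k → Term k n → Term k n
  `0        : Term k n
  `S        : Term k n → Term k n
  _`+_ _`*_ : Term k n → Term k n → Term k n

data Formula (k n : ℕ) : Set where
  _`≡_           : Term k n → Term k n → Formula k n
  `¬_            : Formula k n → Formula k n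
  _`∧_ _`∨_ _`→_ : Formula k n → Formula k n → Formula k n
  `∀_ `∃_        : Formula k (suc n) → Formula k n

evalTerm : ∀ {k n} → Term k n → Vec (Tp 1) k → Vec ℕ n → ℕ
evalTerm (var i)   hs xs = lookup xs i
evalTerm (app i t) hs xs = lookup hs i (evalTerm t hs xs)
evalTerm `0        hs xs = 0
evalTerm (`S t)    hs xs = suc (evalTerm t hs xs)
evalTerm (s `+ t)  hs xs = evalTerm s hs xs + evalTerm t hs xs
evalTerm (s `* t)  hs xs = evalTerm s hs xs * evalTerm t hs xs

Sat : ∀ {k n} → Formula k n → Vec (Tp 1) k → Vec ℕ n → Set
Sat (s `≡ t) hs xs = evalTerm s hs xs ≡ evalTerm t hs xs
Sat (`¬ φ)   hs xs = ¬ Sat φ hs xs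
Sat (φ `∧ ψ) hs xs = Sat φ hs xs × Sat ψ hs xs
Sat (φ `∨ ψ) hs xs = Sat φ hs xs ⊎ Sat ψ hs xs
Sat (φ `→ ψ) hs xs = Sat φ hs xs → Sat ψ hs xs
Sat (`∀ φ)   hs xs = ∀ x → Sat φ hs (x ∷ xs)
Sat (`∃ φ)   hs xs = ∃ λ x → Sat φ hs (x ∷ xs)

Σ¹₁ Π¹₁ Δ¹₁ : ∀ {n} → Pred (Vec ℕ n) 0ℓ → Set
Σ¹₁ {n} R = ∃ λ k → ∃ λ (φ : Formula k n) → ∀ xs → R xs ⇔ ∃ λ hs → Sat φ hs xs
Π¹₁ {n} R = ∃ λ k → ∃ λ (φ : Formula k n) → ∀ xs → R xs ⇔ (∀ hs → Sat φ hs xs)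
Δ¹₁ R = Σ¹₁ R × Π¹₁ R

Graph : Tp 1 → Pred (Vec ℕ 2) 0ℓ
Graph f (x ∷ y ∷ []) = f x ≡ y

Hyperarithmetical : Tp 1 → Set
Hyperarithmetical f = Δ¹₁ (Graph f)

HyperarithmeticalSeq : List (Tp 1) → Set
HyperarithmeticalSeq = All Hyperarithmetical

{-# OPTIONS --safe #-}
module Submission where

-- It suffices to find G and f ∈ 2^ℕ such that f ∉ [ḡ G(g)] for every hyperarithmetical g.  Prefixes of satisfaction
-- tables for Σ¹₁ formulas form a forest ≺ on ℕ whose accessible part is Π¹₁-complete.  On accessible nodes the
-- comparison of ranks H(s,t) is the only solution of the local condition
--   t has rank at most s  ⇔  every t′ ≺ t has rank at most some s′ ≺ s.
-- The nodes e below which some H satisfies it, together with an arithmetical minimality condition, form a Σ¹₁ set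
-- containing all accessible nodes, hence also an inaccessible e; let f be the corresponding H,
-- truncated at 1.  A hyperarithmetical g cannot be locally correct at all accessible nodes below an inaccessible τ ≺ e: diagonalizing
-- g against the universal Σ¹₁ set would yield a Σ¹₁ definition of accessibility.  So g has a minimal fault below e,
-- and every minimal fault of g sits at an accessible node, where f is determined by its values below and therefore
-- differs from g.  The search for a minimal fault is arithmetical in g, hence computable in ∃², and G(g) is its
-- code plus one.

open import Defs
open import Axiom.ExcludedMiddle using (ExcludedMiddle)
open import Axiom.Extensionality.Propositional using (Extensionality)
open import Data.Empty using (⊥; ⊥-elim)
open import Data.Fin using (Fin; zero; suc; toℕ)
open import Data.List using (List; []; _∷_; _++_; applyUpTo; length; reverse; _ʳ++_)
open import Data.List.Properties using
  (++-assoc; ++-identityʳ; length-++; length-applyUpTo; length-reverse; reverse-involutive; unfold-reverse;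
   ʳ++-defn; ∷-injective)
open import Data.List.Relation.Unary.All using (lookupWith)
open import Data.Nat
open import Data.Nat.Properties
open import Data.Product using (∃; _×_; _,_; proj₁; proj₂)
open import Data.Product.Function.NonDependent.Propositional using (_×-⇔_)
open import Data.Sum using (_⊎_; inj₁; inj₂; [_,_])
open import Data.Sum.Function.Propositional using (_⊎-⇔_)
open import Data.Vec using (Vec; []; _∷_; lookup; tabulate)
open import Data.Vec.Properties using (lookup∘tabulate)
open import Function using (_∘_; id)
open import Function.Bundles using (_⇔_; mk⇔; Equivalence)
open import Function.Properties.Equivalence using () renaming (refl to ⇔-refl; trans to ⇔-trans)
open import Function.Related.TypeIsomorphisms using (→-cong-⇔; ¬-cong-⇔)
open import Induction.WellFounded using (Acc; acc)
open import Level using (0ℓ)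
open import Relation.Binary.Definitions using (tri<; tri≈; tri>)
open import Relation.Binary.PropositionalEquality hiding ([_])
open import Relation.Nullary using (¬_; Dec; yes; no; decidable-stable)

open Equivalence using (to; from)

-- A term language for computations in `E`, and its S1-S9 indices.

variable
  k n : ℕ

-- Except for `wk`, each constructor mirrors a Kleene scheme. The schemes act on the first argument,
-- so `hd`, `sc` and `orc` read only the variable in front.
data Core : ℕ → Set where
  zer       : Core n
  sc hd orc : Core (suc n)
  wk        : Core n → Core (suc n)
  bind      : Core n → Core (suc n) → Core n
  rec       : Core n → Core (2 + n) → Core (suc n)
  ex        : Core (suc n) → Core n

primRec : ℕ → (ℕ → ℕ → ℕ) → ℕ → ℕ
primRec b s zero    = b
primRec b s (suc x) = s x (primRec b s x)

module _ (E : Tp 2) where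

  eval : Core n → Tp 1 → Vec ℕ n → ℕ
  eval zer        h xs       = 0
  eval sc         h (x ∷ xs) = suc x
  eval hd         h (x ∷ xs) = x
  eval orc        h (x ∷ xs) = h x
  eval (wk t)     h (x ∷ xs) = eval t h xs
  eval (bind s t) h xs       = eval t h (eval s h xs ∷ xs)
  eval (rec b s)  h (x ∷ xs) = primRec (eval b h xs) (λ m a → eval s h (m ∷ a ∷ xs)) x
  eval (ex t)     h xs       = E (λ m → eval t h (m ∷ xs))

rotate : ℕ → ℕ → ℕ → ℕ
rotate p zero    d = d
rotate p (suc j) d = ⟨ 6 ∷ p ∷ rotate p j d ∷ [] ⟩

-- S1–S9 have no weakening: wk t is a primitive recursion (S5) whose step returns the previous value.  For ex,
-- S6 first brings E to the front as S8 requires; inside S8, rotate moves E behind the numbers again.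
index : Core n → ℕ
index zer            = ⟨ 2 ∷ 0 ∷ [] ⟩
index sc             = ⟨ 1 ∷ [] ⟩
index hd             = ⟨ 3 ∷ [] ⟩
index {suc n} orc    = ⟨ 6 ∷ suc n ∷ ⟨ 7 ∷ [] ⟩ ∷ [] ⟩
index (wk t)         = ⟨ 5 ∷ index t ∷ ⟨ 6 ∷ 1 ∷ ⟨ 3 ∷ [] ⟩ ∷ [] ⟩ ∷ [] ⟩
index (bind s t)     = ⟨ 4 ∷ index t ∷ index s ∷ [] ⟩
index (rec b s)      = ⟨ 5 ∷ index b ∷ index s ∷ [] ⟩
index {n} (ex t)     =
  ⟨ 6 ∷ suc n ∷ ⟨ 8 ∷ rotate (2 + n) (suc n) ⟨ 6 ∷ suc n ∷ index t ∷ [] ⟩ ∷ [] ⟩ ∷ [] ⟩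

numbers : Vec ℕ n → List Arg
numbers []       = []
numbers (x ∷ xs) = (0 , x) ∷ numbers xs

length-numbers : (xs : Vec ℕ n) → length (numbers xs) ≡ n
length-numbers []       = refl
length-numbers (x ∷ xs) = cong suc (length-numbers xs)

front : ∀ {d j as} bs {a} cs {m} → length bs ≡ j → as ≡ bs ++ a ∷ cs →
        ⟪ d ⟫⟨ a ∷ bs ++ cs ⟩≃ m → ⟪ ⟨ 6 ∷ j ∷ d ∷ [] ⟩ ⟫⟨ as ⟩≃ m
front bs cs refl refl p = S6 bs cs p

retype : ∀ {d as bs m} → as ≡ bs → ⟪ d ⟫⟨ as ⟩≃ m → ⟪ d ⟫⟨ bs ⟩≃ m
retype refl p = p

-- Each S6 brings the last argument to the front. Listing the arguments to be moved in reverse makes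
-- the next one the head of `rs`, so that induction on `rs` treats one move at a time.
rotate-reverse : ∀ {d m} p rs ys → length rs + length ys ≡ suc p →
  ⟪ d ⟫⟨ rs ʳ++ ys ⟩≃ m → ⟪ rotate p (length rs) d ⟫⟨ ys ++ reverse rs ⟩≃ m
rotate-reverse p []       ys eq q = retype (sym (++-identityʳ ys)) q
rotate-reverse p (r ∷ rs) ys eq q =
  front (ys ++ reverse rs) [] len
    (trans (cong (ys ++_) (unfold-reverse r rs)) (sym (++-assoc ys (reverse rs) (r ∷ []))))
    (retype (cong (r ∷_) (sym (++-identityʳ (ys ++ reverse rs))))
      (rotate-reverse p rs (r ∷ ys) (trans (+-suc (length rs) (length ys)) eq) q))
  where
  len : length (ys ++ reverse rs) ≡ p
  len = begin
    length (ys ++ reverse rs)          ≡⟨ length-++ ys ⟩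
    length ys + length (reverse rs)    ≡⟨ cong (length ys +_) (length-reverse rs) ⟩
    length ys + length rs              ≡⟨ +-comm (length ys) (length rs) ⟩
    length rs + length ys              ≡⟨ suc-injective eq ⟩
    p                                  ∎
    where open ≡-Reasoning

rotate-correct : ∀ {d j m} p zs ys → length zs ≡ j → j + length ys ≡ suc p →
  ⟪ d ⟫⟨ zs ++ ys ⟩≃ m → ⟪ rotate p j d ⟫⟨ ys ++ zs ⟩≃ m
rotate-correct {d} {_} {m} p zs ys refl eq q =
  subst₂ (λ j as → ⟪ rotate p j d ⟫⟨ ys ++ as ⟩≃ m) (length-reverse zs) (reverse-involutive zs)
    (rotate-reverse p (reverse zs) ys (trans (cong (_+ length ys) (length-reverse zs)) eq)
      (retype (trans (cong (_++ ys) (sym (reverse-involutive zs))) (sym (ʳ++-defn (reverse zs)))) q))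

module _ (E : Tp 2) where

  args : Tp 1 → Vec ℕ n → List Arg
  args f xs = numbers xs ++ (1 , f) ∷ (2 , E) ∷ []

  index-correct : (t : Core n) (f : Tp 1) (xs : Vec ℕ n) →
                  ⟪ index t ⟫⟨ args f xs ⟩≃ eval E t f xs
  index-correct zer        f xs       = S2
  index-correct sc         f (x ∷ xs) = S1
  index-correct hd         f (x ∷ xs) = S3
  index-correct orc        f (x ∷ xs) =
    front ((0 , x) ∷ numbers xs) ((2 , E) ∷ []) (cong suc (length-numbers xs)) refl S7
  index-correct (wk t)     f (x ∷ xs) = drop x
    where
    drop : ∀ x → ⟪ index (wk t) ⟫⟨ (0 , x) ∷ args f xs ⟩≃ eval E t f xs
    drop zero    = S5-zero (index-correct t f xs)
    drop (suc x) = S5-suc (drop x) (S6 ((0 , x) ∷ []) (args f xs) S3)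
  index-correct (bind s t) f xs       =
    S4 (index-correct s f xs) (index-correct t f (eval E s f xs ∷ xs))
  index-correct (rec b s)  f (x ∷ xs) = iterate x
    where
    iterate : ∀ x → ⟪ index (rec b s) ⟫⟨ (0 , x) ∷ args f xs ⟩≃ eval E (rec b s) f (x ∷ xs)
    iterate zero    = S5-zero (index-correct b f xs)
    iterate (suc x) = S5-suc (iterate x) (index-correct s f (x ∷ _ ∷ xs))
  index-correct {n} (ex t) f xs       =
    front zs [] length-zs (sym (++-assoc (numbers xs) _ _))
      (retype (cong ((2 , E) ∷_) (sym (++-identityʳ zs)))
        (S8 λ η →
          rotate-correct (2 + n) zs ((0 , η) ∷ (2 , E) ∷ []) length-zs (+-comm (suc n) 2)
            (front zs ((2 , E) ∷ []) length-zs refl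
              (retype (cong ((0 , η) ∷_) (sym (++-assoc (numbers xs) _ _)))
                (index-correct t f (η ∷ xs))))))
    where
    zs : List Arg
    zs = numbers xs ++ (1 , f) ∷ []
    length-zs : length zs ≡ suc n
    length-zs = trans (length-++ (numbers xs)) (trans (cong (_+ 1) (length-numbers xs)) (+-comm n 1))

  -- Unbounded search by self-application.

  -- The loop receives its own index z as first argument and calls it through S9.
  module _ (t : Core 1) where

    -- On x, y, z, m, f, E the two S4 prepend z and m + 1. The five moves then produce z, z, m + 1,
    -- f, E, x, y, m, so that S9 applies z to the next four arguments.
    again : ℕ
    again = ⟨ 4 ∷ ⟨ 4 ∷
        ⟨ 6 ∷ 7 ∷ ⟨ 6 ∷ 7 ∷ ⟨ 6 ∷ 3 ∷ ⟨ 6 ∷ 3 ∷ ⟨ 6 ∷ 6 ∷ ⟨ 9 ∷ 4 ∷ [] ⟩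
          ∷ [] ⟩ ∷ [] ⟩ ∷ [] ⟩ ∷ [] ⟩ ∷ [] ⟩
      ∷ ⟨ 6 ∷ 3 ∷ ⟨ 3 ∷ [] ⟩ ∷ [] ⟩ ∷ [] ⟩ ∷ ⟨ 6 ∷ 3 ∷ ⟨ 1 ∷ [] ⟩ ∷ [] ⟩ ∷ [] ⟩

    loop : ℕ
    loop = ⟨ 4 ∷ ⟨ 5 ∷ ⟨ 6 ∷ 1 ∷ ⟨ 3 ∷ [] ⟩ ∷ [] ⟩ ∷ again ∷ [] ⟩ ∷ index (wk {n = 1} t) ∷ [] ⟩

    search : ℕ
    search = ⟨ 4 ∷ ⟨ 4 ∷ loop ∷ ⟨ 2 ∷ loop ∷ [] ⟩ ∷ [] ⟩ ∷ ⟨ 2 ∷ 0 ∷ [] ⟩ ∷ [] ⟩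

    module _ (f : Tp 1) where

      again-correct : ∀ {x y z m r} → ⟪ z ⟫⟨ args f (z ∷ suc m ∷ []) ⟩≃ r →
                      ⟪ again ⟫⟨ args f (x ∷ y ∷ z ∷ m ∷ []) ⟩≃ r
      again-correct {x} {y} {z} {m} p =
        S4 (S6 ((0 , x) ∷ (0 , y) ∷ (0 , z) ∷ []) _ S1)
          (S4 (S6 ((0 , suc m) ∷ (0 , x) ∷ (0 , y) ∷ []) _ S3)
            (S6 ((0 , z) ∷ (0 , suc m) ∷ (0 , x) ∷ (0 , y) ∷ (0 , z) ∷ (0 , m) ∷ (1 , f) ∷ []) []
              (S6 ((2 , E) ∷ (0 , z) ∷ (0 , suc m) ∷ (0 , x) ∷ (0 , y) ∷ (0 , z) ∷ (0 , m) ∷ []) []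
                (S6 ((1 , f) ∷ (2 , E) ∷ (0 , z) ∷ []) _
                  (S6 ((0 , suc m) ∷ (1 , f) ∷ (2 , E) ∷ []) _
                    (S6 ((0 , z) ∷ (0 , suc m) ∷ (1 , f) ∷ (2 , E) ∷ (0 , x) ∷ (0 , y) ∷ []) _
                      (S9 (args f (z ∷ suc m ∷ [])) _ p)))))))

      -- S5 also evaluates all earlier stages, so each of them must terminate: stage 0 returns m,
      -- and every later stage ignores the previous value and repeats the call of z.
      branch : ∀ {z m r} v → ⟪ z ⟫⟨ args f (z ∷ suc m ∷ []) ⟩≃ r →
        ⟪ ⟨ 5 ∷ ⟨ 6 ∷ 1 ∷ ⟨ 3 ∷ [] ⟩ ∷ [] ⟩ ∷ again ∷ [] ⟩ ⟫⟨ args f (suc v ∷ z ∷ m ∷ []) ⟩≃ r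
      branch {z} zero    p = S5-suc (S5-zero (S6 ((0 , z) ∷ []) _ S3)) (again-correct p)
      branch     (suc v) p = S5-suc (branch v p) (again-correct p)

      -- Induction on the distance d from m to a known zero; the loop may stop at an earlier zero.
      loop-correct : ∀ d m → eval E t f (d + m ∷ []) ≡ 0 →
        ∃ λ r → ⟪ loop ⟫⟨ args f (loop ∷ m ∷ []) ⟩≃ r × eval E t f (r ∷ []) ≡ 0
      loop-correct d m p with eval E t f (m ∷ []) in eq | index-correct (wk {n = 1} t) f (loop ∷ m ∷ [])
      loop-correct d       m p | zero  | q =
        m , S4 q (S5-zero (S6 ((0 , loop) ∷ []) _ S3)) , eq
      loop-correct zero    m p | suc v | q with () ← trans (sym eq) p
      loop-correct (suc d) m p | suc v | q
        with r , c , z ← loop-correct d (suc m) (trans (cong (λ j → eval E t f (j ∷ [])) (+-suc d m)) p)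
        = r , S4 q (branch v c) , z

      search-correct : ∀ m → eval E t f (m ∷ []) ≡ 0 →
        ∃ λ r → ⟪ search ⟫⟨ args f [] ⟩≃ r × eval E t f (r ∷ []) ≡ 0
      search-correct m p
        with r , c , z ← loop-correct m 0 (trans (cong (λ j → eval E t f (j ∷ [])) (+-identityʳ m)) p)
        = r , S4 S2 (S4 S2 c) , z

module Construction (em : ExcludedMiddle 0ℓ) (E : Tp 2) (E-spec : Is∃² E) where

  E⇔ : ∀ f → E f ≡ 0 ⇔ ∃ λ n → f n ≡ 0
  E⇔ f = proj₂ (E-spec f)

  E≢0⇒≡1 : ∀ f → E f ≢ 0 → E f ≡ 1
  E≢0⇒≡1 f = one (proj₁ (E-spec f))
    where
    one : ∀ {v} → v < 2 → v ≢ 0 → v ≡ 1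
    one {zero}        _ v≢0 = ⊥-elim (v≢0 refl)
    one {suc zero}    _ _   = refl
    one {suc (suc v)} (s≤s (s≤s ())) _

  ⟦_⟧ : Core n → Tp 1 → Vec ℕ n → ℕ
  ⟦_⟧ = eval E

  -- Pairing, projections and lists inside the term language.

  opaque
    -- A polynomial, hence also expressible as a `Term`. The successor makes both components smaller
    -- than the pair and leaves 0 for the empty list.
    π : ℕ → ℕ → ℕ
    π a b = suc ((a + b) * (a + b) + a)

    a<π : ∀ a b → a < π a b
    a<π a b = s≤s (m≤n+m a _)

    b<π : ∀ a b → b < π a b
    b<π zero    zero    = s≤s z≤n
    b<π a       (suc b) = s≤s (≤-trans (≤-trans (m≤n+m (suc b) a) (square (a + suc b))) (m≤m+n _ a))
      where
      square : ∀ m → m ≤ m * m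
      square zero    = z≤n
      square (suc m) = m≤m+n (suc m) (m * suc m)
    b<π (suc a) zero    = s≤s z≤n

    π-diagonal : ∀ {a b c d} → a + b < c + d → π a b < π c d
    π-diagonal {a} {b} {c} {d} p = s≤s (begin-strict
      (a + b) * (a + b) + a              ≤⟨ +-monoʳ-≤ _ (m≤m+n a b) ⟩
      (a + b) * (a + b) + (a + b)        ≡⟨ +-comm ((a + b) * (a + b)) (a + b) ⟩
      suc (a + b) * (a + b)              <⟨ *-monoʳ-< (suc (a + b)) (n<1+n (a + b)) ⟩
      suc (a + b) * suc (a + b)          ≤⟨ *-mono-≤ p p ⟩
      (c + d) * (c + d)                  ≤⟨ m≤m+n _ c ⟩
      (c + d) * (c + d) + c              ∎)
      where open ≤-Reasoning

    π-injective : ∀ {a b c d} → π a b ≡ π c d → a ≡ c × b ≡ d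
    π-injective {a} {b} {c} {d} eq with <-cmp (a + b) (c + d)
    ... | tri< p _ _ = ⊥-elim (<-irrefl eq (π-diagonal {a} {b} {c} {d} p))
    ... | tri> _ _ p = ⊥-elim (<-irrefl (sym eq) (π-diagonal {c} {d} {a} {b} p))
    ... | tri≈ _ p _ = a≡c , +-cancelˡ-≡ a b d (trans p (cong (_+ d) (sym a≡c)))
      where
      a≡c : a ≡ c
      a≡c = +-cancelˡ-≡ ((a + b) * (a + b)) a c
              (trans (suc-injective eq) (cong (λ s → s * s + c) (sym p)))

  -- 0 is the truth value "true".

  ifz : ℕ → ℕ → ℕ → ℕ
  ifz c a b = primRec a (λ _ _ → b) c

  ifzᶜ : Core n → Core n → Core n → Core n
  ifzᶜ c a b = bind c (rec a (wk (wk b)))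

  oneᶜ : Core n
  oneᶜ = bind zer sc

  _+ᶜ_ _*ᶜ_ _∸ᶜ_ _≡ᶜ_ _∧ᶜ_ _∨ᶜ_ _⇒ᶜ_ : Core n → Core n → Core n
  s +ᶜ t = bind s (rec t (bind (wk hd) sc))
  s *ᶜ t = bind s (rec zer (wk (wk t) +ᶜ wk hd))
  s ∸ᶜ t = bind t (rec s (bind (wk hd) (rec zer hd)))
  s ≡ᶜ t = (s ∸ᶜ t) +ᶜ (t ∸ᶜ s)
  s ∧ᶜ t = ifzᶜ s t oneᶜ
  s ∨ᶜ t = ifzᶜ s zer t
  s ⇒ᶜ t = ifzᶜ s t zer

  ¬ᶜ_ : Core n → Core n
  ¬ᶜ t = ifzᶜ t oneᶜ zer

  πᶜ : Core n → Core n → Core n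
  πᶜ s t = bind (((s +ᶜ t) *ᶜ (s +ᶜ t)) +ᶜ s) sc

  module _ (h : Tp 1) (xs : Vec ℕ n) where

    +ᶜ-correct : ∀ s t → ⟦ s +ᶜ t ⟧ h xs ≡ ⟦ s ⟧ h xs + ⟦ t ⟧ h xs
    +ᶜ-correct s t = go (⟦ s ⟧ h xs)
      where
      go : ∀ x → primRec (⟦ t ⟧ h xs) (λ _ a → suc a) x ≡ x + ⟦ t ⟧ h xs
      go zero    = refl
      go (suc x) = cong suc (go x)

    ∸ᶜ-correct : ∀ s t → ⟦ s ∸ᶜ t ⟧ h xs ≡ ⟦ s ⟧ h xs ∸ ⟦ t ⟧ h xs
    ∸ᶜ-correct s t = go (⟦ t ⟧ h xs)
      where
      pred′ : ∀ x → primRec 0 (λ m _ → m) x ≡ pred x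
      pred′ zero    = refl
      pred′ (suc x) = refl
      go : ∀ x → primRec (⟦ s ⟧ h xs) (λ _ a → primRec 0 (λ m _ → m) a) x ≡ ⟦ s ⟧ h xs ∸ x
      go zero    = refl
      go (suc x) = trans (pred′ (primRec (⟦ s ⟧ h xs) (λ _ a → primRec 0 (λ m _ → m) a) x))
        (trans (cong pred (go x)) (pred[m∸n]≡m∸[1+n] (⟦ s ⟧ h xs) x))

  *ᶜ-correct : ∀ (h : Tp 1) (xs : Vec ℕ n) s t → ⟦ s *ᶜ t ⟧ h xs ≡ ⟦ s ⟧ h xs * ⟦ t ⟧ h xs
  *ᶜ-correct h xs s t = go (⟦ s ⟧ h xs)
    where
    go : ∀ x → ⟦ rec zer (wk (wk t) +ᶜ wk hd) ⟧ h (x ∷ xs) ≡ x * ⟦ t ⟧ h xs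
    go zero    = refl
    go (suc x) = trans (+ᶜ-correct h (x ∷ _ ∷ xs) (wk (wk t)) (wk hd)) (cong (⟦ t ⟧ h xs +_) (go x))

  opaque
    unfolding π
    πᶜ-correct : ∀ (h : Tp 1) (xs : Vec ℕ n) s t → ⟦ πᶜ s t ⟧ h xs ≡ π (⟦ s ⟧ h xs) (⟦ t ⟧ h xs)
    πᶜ-correct h xs s t = cong suc
      (trans (+ᶜ-correct h xs ((s +ᶜ t) *ᶜ (s +ᶜ t)) s) (cong (_+ ⟦ s ⟧ h xs)
        (trans (*ᶜ-correct h xs (s +ᶜ t) (s +ᶜ t))
          (cong₂ _*_ (+ᶜ-correct h xs s t) (+ᶜ-correct h xs s t)))))

  ≡ᶜ-correct : ∀ (h : Tp 1) (xs : Vec ℕ n) s t → ⟦ s ≡ᶜ t ⟧ h xs ≡ 0 ⇔ ⟦ s ⟧ h xs ≡ ⟦ t ⟧ h xs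
  ≡ᶜ-correct h xs s t = mk⇔
    (λ p → let q = trans (sym value) p in
       ≤-antisym (m∸n≡0⇒m≤n (m+n≡0⇒m≡0 _ q)) (m∸n≡0⇒m≤n (m+n≡0⇒n≡0 (a ∸ b) q)))
    (λ p → trans value (cong₂ _+_ (m≤n⇒m∸n≡0 (≤-reflexive p)) (m≤n⇒m∸n≡0 (≤-reflexive (sym p)))))
    where
    a = ⟦ s ⟧ h xs
    b = ⟦ t ⟧ h xs
    value : ⟦ s ≡ᶜ t ⟧ h xs ≡ (a ∸ b) + (b ∸ a)
    value = trans (+ᶜ-correct h xs (s ∸ᶜ t) (t ∸ᶜ s)) (cong₂ _+_ (∸ᶜ-correct h xs s t) (∸ᶜ-correct h xs t s))

  -- Projections of z: the last k < z such that z is π k b (respectively π b k) for some b.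

  find : (ℕ → ℕ) → ℕ → ℕ
  find t = primRec 0 (λ k m → ifz (t k) k m)

  find-≤ : ∀ t c → find t (suc c) ≤ c
  find-≤ t c with t c
  find-≤ t c       | zero  = ≤-refl
  find-≤ t zero    | suc _ = ≤-refl
  find-≤ t (suc c) | suc _ = m≤n⇒m≤1+n (find-≤ t c)

  find-unique : ∀ t {k} z → k < z → t k ≡ 0 → (∀ j → t j ≡ 0 → j ≡ k) → find t z ≡ k
  find-unique t {k} (suc z) (s≤s k≤z) hit uniq with t z in eq
  ... | zero  = uniq z eq
  ... | suc v = find-unique t z (≤∧≢⇒< k≤z (λ { refl → 1+n≢0 (trans (sym eq) hit) })) hit uniq

  -- p is meant to denote a pair formed from the bound variable (first) and k (second).
  projᶜ : (∀ {m} → Core (2 + m)) → Core n → Core n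
  projᶜ p z = bind z (bind hd (rec zer (ifzᶜ (ex (p ≡ᶜ wk (wk (wk hd)))) hd (wk hd))))

  fstᶜ sndᶜ : Core n → Core n
  fstᶜ = projᶜ (πᶜ (wk hd) hd)
  sndᶜ = projᶜ (πᶜ hd (wk hd))

  opaque
    -- Values of the terms themselves, so that `ATᶜ-correct` becomes `refl`.
    fst′ snd′ : ℕ → ℕ
    fst′ z = ⟦ fstᶜ {1} hd ⟧ (λ _ → 0) (z ∷ [])
    snd′ z = ⟦ sndᶜ {1} hd ⟧ (λ _ → 0) (z ∷ [])

    private
      test : (∀ {m} → Core (2 + m)) → ℕ → ℕ → ℕ
      test p z k = ⟦ ex (p ≡ᶜ wk (wk (wk hd))) ⟧ (λ _ → 0) (k ∷ 0 ∷ z ∷ [])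

    fst′-≤ : ∀ c → fst′ (suc c) ≤ c
    fst′-≤ c = find-≤ (test (πᶜ (wk hd) hd) (suc c)) c

    snd′-≤ : ∀ c → snd′ (suc c) ≤ c
    snd′-≤ c = find-≤ (test (πᶜ hd (wk hd)) (suc c)) c

    find-test : ∀ (p : ∀ {m} → Core (2 + m)) z {k} → k < z →
      (∀ j → (∃ λ b → ⟦ p ⟧ (λ _ → 0) (b ∷ j ∷ 0 ∷ z ∷ []) ≡ z) ⇔ j ≡ k) → find (test p z) z ≡ k
    find-test p z {k} k<z spec = find-unique (test p z) z k<z
      (from (E⇔ _) (let b , q = from (spec k) refl in b , from (eq k b) q))
      (λ j q → let b , r = to (E⇔ _) q in to (spec j) (b , to (eq j b) r))
      where
      eq : ∀ j b → ⟦ p ≡ᶜ wk (wk (wk hd)) ⟧ (λ _ → 0) (b ∷ j ∷ 0 ∷ z ∷ []) ≡ 0 ⇔ ⟦ p ⟧ (λ _ → 0) (b ∷ j ∷ 0 ∷ z ∷ []) ≡ z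
      eq j b = ≡ᶜ-correct (λ _ → 0) (b ∷ j ∷ 0 ∷ z ∷ []) p (wk (wk (wk hd)))

    fst′-zero : fst′ 0 ≡ 0
    fst′-zero = refl

    snd′-zero : snd′ 0 ≡ 0
    snd′-zero = refl

    fst′-π : ∀ a b → fst′ (π a b) ≡ a
    fst′-π a b = find-test (πᶜ (wk hd) hd) (π a b) (a<π a b) λ j → mk⇔
      (λ (m , q) → proj₁ (π-injective (trans (sym (πᶜ-correct (λ _ → 0) (m ∷ j ∷ 0 ∷ π a b ∷ []) (wk hd) hd)) q)))
      (λ { refl → b , πᶜ-correct (λ _ → 0) (b ∷ j ∷ 0 ∷ π a b ∷ []) (wk hd) hd })

    snd′-π : ∀ a b → snd′ (π a b) ≡ b
    snd′-π a b = find-test (πᶜ hd (wk hd)) (π a b) (b<π a b) λ j → mk⇔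
      (λ (m , q) → proj₂ (π-injective (trans (sym (πᶜ-correct (λ _ → 0) (m ∷ j ∷ 0 ∷ π a b ∷ []) hd (wk hd))) q)))
      (λ { refl → a , πᶜ-correct (λ _ → 0) (a ∷ j ∷ 0 ∷ π a b ∷ []) hd (wk hd) })

  -- AT (π p q) is the q-th entry of the list coded by p.
  AT : Tp 1
  AT z = fst′ (primRec (fst′ z) (λ _ a → snd′ a) (snd′ z))

  ATᶜ : Core (suc n)
  ATᶜ = fstᶜ (bind (fstᶜ hd) (bind (sndᶜ (wk hd)) (rec hd (sndᶜ (wk hd)))))

  opaque
    unfolding fst′ snd′
    ATᶜ-correct : ∀ (h : Tp 1) x (xs : Vec ℕ n) → ⟦ ATᶜ ⟧ h (x ∷ xs) ≡ AT x
    ATᶜ-correct h x xs = refl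

  at : ℕ → ℕ → ℕ
  at p q = AT (π p q)

  at-π : ∀ p q → at p q ≡ fst′ (primRec p (λ _ a → snd′ a) q)
  at-π p q = cong₂ (λ p q → fst′ (primRec p (λ _ a → snd′ a) q)) (fst′-π p q) (snd′-π p q)

  at-zero : ∀ a p → at (π a p) 0 ≡ a
  at-zero a p = trans (at-π (π a p) 0) (fst′-π a p)

  at-suc : ∀ a p q → at (π a p) (suc q) ≡ at p q
  at-suc a p q = trans (at-π (π a p) (suc q)) (trans (cong fst′ (tails q)) (sym (at-π p q)))
    where
    tails : ∀ q → primRec (π a p) (λ _ a → snd′ a) (suc q) ≡ primRec p (λ _ a → snd′ a) q
    tails zero    = snd′-π a p
    tails (suc q) = cong snd′ (tails q)

  restrict : (ℕ → ℕ) → ℕ → ℕ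
  restrict u zero    = 0
  restrict u (suc L) = π (u 0) (restrict (λ q → u (suc q)) L)

  at-restrict : ∀ u {L q} → q < L → at (restrict u L) q ≡ u q
  at-restrict u {suc L} {zero}  _         = at-zero (u 0) _
  at-restrict u {suc L} {suc q} (s≤s q<L) =
    trans (at-suc (u 0) _ q) (at-restrict (λ q → u (suc q)) q<L)

  -- Terms that evaluate arithmetical formulas.

  var′ : Fin n → Core n
  var′ zero    = hd
  var′ (suc i) = wk (var′ i)

  var′-correct : ∀ (i : Fin n) h xs → ⟦ var′ i ⟧ h xs ≡ lookup xs i
  var′-correct zero    h (x ∷ xs) = refl
  var′-correct (suc i) h (x ∷ xs) = var′-correct i h xs

  Functions : ℕ → Set
  Functions k = Fin k → ∀ {n} → Core (suc n)

  Denotes : Functions k → Tp 1 → Vec (Tp 1) k → Set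
  Denotes {k} ρ h hs = ∀ (i : Fin k) {n} x (xs : Vec ℕ n) → ⟦ ρ i ⟧ h (x ∷ xs) ≡ lookup hs i x

  lift : ∀ {m} → (Fin n → Fin m) → Fin (suc n) → Fin (suc m)
  lift θ zero    = zero
  lift θ (suc i) = suc (θ i)

  Renames : ∀ {m} → (Fin n → Fin m) → Vec ℕ n → Vec ℕ m → Set
  Renames {n} θ xs ys = ∀ (i : Fin n) → lookup ys (θ i) ≡ lookup xs i

  lift-renames : ∀ {m} {θ : Fin n → Fin m} {xs ys} → Renames θ xs ys → ∀ x → Renames (lift θ) (x ∷ xs) (x ∷ ys)
  lift-renames r x zero    = refl
  lift-renames r x (suc i) = r i

  term : ∀ {m} → Functions k → (Fin n → Fin m) → Term k n → Core m
  term ρ θ (var i)   = var′ (θ i)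
  term ρ θ (app i t) = bind (term ρ θ t) (ρ i)
  term ρ θ `0        = zer
  term ρ θ (`S t)    = bind (term ρ θ t) sc
  term ρ θ (s `+ t)  = term ρ θ s +ᶜ term ρ θ t
  term ρ θ (s `* t)  = term ρ θ s *ᶜ term ρ θ t

  formula : ∀ {m} → Functions k → (Fin n → Fin m) → Formula k n → Core m
  formula ρ θ (s `≡ t) = term ρ θ s ≡ᶜ term ρ θ t
  formula ρ θ (`¬ φ)   = ¬ᶜ formula ρ θ φ
  formula ρ θ (φ `∧ ψ) = formula ρ θ φ ∧ᶜ formula ρ θ ψ
  formula ρ θ (φ `∨ ψ) = formula ρ θ φ ∨ᶜ formula ρ θ ψ
  formula ρ θ (φ `→ ψ) = formula ρ θ φ ⇒ᶜ formula ρ θ ψ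
  formula ρ θ (`∀ φ)   = ¬ᶜ ex (¬ᶜ formula ρ (lift θ) φ)
  formula ρ θ (`∃ φ)   = ex (formula ρ (lift θ) φ)

  True : ℕ → Set
  True v = v ≡ 0

  ¬-true : ∀ {v} {P : Set} → True v ⇔ P → True (ifz v 1 0) ⇔ (¬ P)
  ¬-true {zero}  v⇔P = mk⇔ (λ ()) (λ ¬p → ⊥-elim (¬p (to v⇔P refl)))
  ¬-true {suc v} v⇔P = mk⇔ (λ _ p → 1+n≢0 (from v⇔P p)) (λ _ → refl)

  ∧-true : ∀ {v w} {P Q : Set} → True v ⇔ P → True w ⇔ Q → True (ifz v w 1) ⇔ (P × Q)
  ∧-true {zero}  v⇔P w⇔Q = mk⇔ (λ q → to v⇔P refl , to w⇔Q q) (λ (_ , q) → from w⇔Q q)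
  ∧-true {suc v} v⇔P w⇔Q = mk⇔ (λ ()) (λ (p , _) → ⊥-elim (1+n≢0 (from v⇔P p)))

  ∨-true : ∀ {v w} {P Q : Set} → True v ⇔ P → True w ⇔ Q → True (ifz v 0 w) ⇔ (P ⊎ Q)
  ∨-true {zero}  v⇔P w⇔Q = mk⇔ (λ _ → inj₁ (to v⇔P refl)) (λ _ → refl)
  ∨-true {suc v} v⇔P w⇔Q =
    mk⇔ (λ q → inj₂ (to w⇔Q q)) [ (λ p → ⊥-elim (1+n≢0 (from v⇔P p))) , from w⇔Q ]

  ⇒-true : ∀ {v w} {P Q : Set} → True v ⇔ P → True w ⇔ Q → True (ifz v w 0) ⇔ (P → Q)
  ⇒-true {zero}  v⇔P w⇔Q = mk⇔ (λ q _ → to w⇔Q q) (λ p→q → from w⇔Q (p→q (to v⇔P refl)))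
  ⇒-true {suc v} v⇔P w⇔Q = mk⇔ (λ _ p → ⊥-elim (1+n≢0 (from v⇔P p))) (λ _ → refl)

  ∃-true : ∀ {f : ℕ → ℕ} {P : ℕ → Set} → (∀ x → True (f x) ⇔ P x) → True (E f) ⇔ ∃ P
  ∃-true {f} f⇔P = mk⇔
    (λ p → let x , q = to (E⇔ f) p in x , to (f⇔P x) q)
    (λ (x , q) → from (E⇔ f) (x , from (f⇔P x) q))

  ∀-true : ∀ {f : ℕ → ℕ} {P : ℕ → Set} → (∀ x → True (f x) ⇔ P x) →
           True (ifz (E (λ x → ifz (f x) 1 0)) 1 0) ⇔ (∀ x → P x)
  ∀-true {f} {P} f⇔P = mk⇔
    (λ p x → to (f⇔P x) (stable (λ ¬q → to no-counterexample p (x , ¬q))))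
    (λ p → from no-counterexample (λ (x , ¬q) → ¬q (from (f⇔P x) (p x))))
    where
    no-counterexample : True (ifz (E (λ x → ifz (f x) 1 0)) 1 0) ⇔ (¬ ∃ λ x → ¬ True (f x))
    no-counterexample = ¬-true (∃-true λ x → ¬-true (mk⇔ (λ p → p) (λ p → p)))
    stable : ∀ {v} → ¬ ¬ True v → True v
    stable {zero}  _   = refl
    stable {suc v} ¬¬p = ⊥-elim (¬¬p λ ())

  module _ {ρ : Functions k} {h : Tp 1} {hs : Vec (Tp 1) k} (ρ≈hs : Denotes ρ h hs) where

    term-correct : ∀ {m} {θ : Fin n → Fin m} {xs ys} → Renames θ xs ys →
                   ∀ t → ⟦ term ρ θ t ⟧ h ys ≡ evalTerm t hs xs
    term-correct {θ = θ} r (var i)   = trans (var′-correct (θ i) h _) (r i)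
    term-correct r (app i t) = trans (ρ≈hs i _ _) (cong (lookup hs i) (term-correct r t))
    term-correct r `0        = refl
    term-correct r (`S t)    = cong suc (term-correct r t)
    term-correct r (s `+ t)  = trans (+ᶜ-correct h _ (term ρ _ s) (term ρ _ t))
                                 (cong₂ _+_ (term-correct r s) (term-correct r t))
    term-correct r (s `* t)  = trans (*ᶜ-correct h _ (term ρ _ s) (term ρ _ t))
                                 (cong₂ _*_ (term-correct r s) (term-correct r t))

    formula-correct : ∀ {m} {θ : Fin n → Fin m} {xs ys} → Renames θ xs ys →
                      ∀ φ → True (⟦ formula ρ θ φ ⟧ h ys) ⇔ Sat φ hs xs
    formula-correct r (s `≡ t) = mk⇔
      (λ p → trans (sym (term-correct r s)) (trans (to eq p) (term-correct r t)))
      (λ p → from eq (trans (term-correct r s) (trans p (sym (term-correct r t)))))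
      where eq = ≡ᶜ-correct h _ (term ρ _ s) (term ρ _ t)
    formula-correct r (`¬ φ)   = ¬-true (formula-correct r φ)
    formula-correct r (φ `∧ ψ) = ∧-true (formula-correct r φ) (formula-correct r ψ)
    formula-correct r (φ `∨ ψ) = ∨-true (formula-correct r φ) (formula-correct r ψ)
    formula-correct r (φ `→ ψ) = ⇒-true (formula-correct r φ) (formula-correct r ψ)
    formula-correct r (`∀ φ)   = ∀-true λ x → formula-correct (lift-renames r x) φ
    formula-correct r (`∃ φ)   = ∃-true λ x → formula-correct (lift-renames r x) φ

  -- Tables of the values of all coded terms.

  code : ℕ → ℕ → ℕ → ℕ
  code t c d = π t (π c d)

  ⌜_⌝ : Core n → ℕ
  ⌜ zer ⌝      = code 0 0 0
  ⌜ sc ⌝       = code 1 0 0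
  ⌜ hd ⌝       = code 2 0 0
  ⌜ orc ⌝      = code 3 0 0
  ⌜ wk t ⌝     = code 4 ⌜ t ⌝ 0
  ⌜ bind s t ⌝ = code 5 ⌜ s ⌝ ⌜ t ⌝
  ⌜ rec b s ⌝  = code 6 ⌜ b ⌝ ⌜ s ⌝
  ⌜ ex t ⌝     = code 7 ⌜ t ⌝ 0

  oracle : ℕ → ℕ
  oracle x = π (code 8 0 0) x

  -- A table u is meant to hold the value of t at xs at the position π ⌜ t ⌝ ⌜ xs ⌝ᵉ, and the oracle at the
  -- positions with tag 8.  Tag 9 holds, for ex t, a candidate witness.  The clauses relate at most three entries,
  -- "position q holds a", of the table, so that a finite partial table can be tested against them.
  Ok : (q₁ a₁ q₂ a₂ q₃ a₃ : ℕ) → Set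
  Ok q₁ a₁ q₂ a₂ q₃ a₃ = ∀ c d x e →
      (q₁ ≡ π (code 0 0 0) e → a₁ ≡ 0)
    × (q₁ ≡ π (code 1 0 0) (π x e) → a₁ ≡ suc x)
    × (q₁ ≡ π (code 2 0 0) (π x e) → a₁ ≡ x)
    × (q₁ ≡ π (code 3 0 0) (π x e) → q₂ ≡ oracle x → a₁ ≡ a₂)
    × (q₁ ≡ π (code 4 c 0) (π x e) → q₂ ≡ π c e → a₁ ≡ a₂)
    × (q₁ ≡ π (code 5 c d) e → q₂ ≡ π c e → q₃ ≡ π d (π a₂ e) → a₁ ≡ a₃)
    × (q₁ ≡ π (code 6 c d) (π 0 e) → q₂ ≡ π c e → a₁ ≡ a₂)
    × (q₁ ≡ π (code 6 c d) (π (suc x) e) → q₂ ≡ π (code 6 c d) (π x e) →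
         q₃ ≡ π d (π x (π a₂ e)) → a₁ ≡ a₃)
    × (q₁ ≡ π (code 7 c 0) e → q₂ ≡ π (code 9 c 0) e → q₃ ≡ π c (π a₂ e) → a₁ ≡ 0 → a₃ ≡ 0)
    × (q₁ ≡ π (code 7 c 0) e → q₂ ≡ π c (π x e) → a₁ ≡ 0 ⊎ (a₁ ≡ 1 × ¬ a₂ ≡ 0))

  Table : (ℕ → ℕ → Set) → Set
  Table R = ∀ q₁ a₁ q₂ a₂ q₃ a₃ → R q₁ a₁ → R q₂ a₂ → R q₃ a₃ → Ok q₁ a₁ q₂ a₂ q₃ a₃

  IsTable : (ℕ → ℕ) → Set
  IsTable u = Table (λ q a → u q ≡ a)

  ⌜_⌝ᵉ : Vec ℕ n → ℕ
  ⌜ [] ⌝ᵉ     = 0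
  ⌜ x ∷ xs ⌝ᵉ = π x ⌜ xs ⌝ᵉ

  module _ {u : ℕ → ℕ} (table : IsTable u) where

    private
      ok : ∀ q₁ q₂ q₃ → Ok q₁ (u q₁) q₂ (u q₂) q₃ (u q₃)
      ok q₁ q₂ q₃ = table q₁ _ q₂ _ q₃ _ refl refl refl

    -- Induction on the term. Tag 8 is unconstrained, so a table may carry any oracle. For `ex`, tag
    -- 9 supplies a witness if the entry is 0, and the last clause forbids the entry 1 as soon as
    -- some instance is 0.
    table-eval : (t : Core n) (xs : Vec ℕ n) → u (π ⌜ t ⌝ ⌜ xs ⌝ᵉ) ≡ ⟦ t ⟧ (u ∘ oracle) xs
    table-eval zer xs
      with ok-zer , _ ← ok (π (code 0 0 0) ⌜ xs ⌝ᵉ) 0 0 0 0 0 ⌜ xs ⌝ᵉ = ok-zer refl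
    table-eval sc (x ∷ xs)
      with _ , ok-sc , _ ← ok (π (code 1 0 0) ⌜ x ∷ xs ⌝ᵉ) 0 0 0 0 x ⌜ xs ⌝ᵉ = ok-sc refl
    table-eval hd (x ∷ xs)
      with _ , _ , ok-hd , _ ← ok (π (code 2 0 0) ⌜ x ∷ xs ⌝ᵉ) 0 0 0 0 x ⌜ xs ⌝ᵉ = ok-hd refl
    table-eval orc (x ∷ xs)
      with _ , _ , _ , ok-orc , _ ← ok (π (code 3 0 0) ⌜ x ∷ xs ⌝ᵉ) (oracle x) 0 0 0 x ⌜ xs ⌝ᵉ
      = ok-orc refl refl
    table-eval (wk t) (x ∷ xs)
      with _ , _ , _ , _ , ok-wk , _ ← ok (π (code 4 ⌜ t ⌝ 0) ⌜ x ∷ xs ⌝ᵉ) (π ⌜ t ⌝ ⌜ xs ⌝ᵉ) 0 ⌜ t ⌝ 0 x ⌜ xs ⌝ᵉ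
      = trans (ok-wk refl refl) (table-eval t xs)
    table-eval (bind s t) xs
      with _ , _ , _ , _ , _ , ok-bind , _ ← ok (π (code 5 ⌜ s ⌝ ⌜ t ⌝) ⌜ xs ⌝ᵉ) (π ⌜ s ⌝ ⌜ xs ⌝ᵉ)
             (π ⌜ t ⌝ (π (u (π ⌜ s ⌝ ⌜ xs ⌝ᵉ)) ⌜ xs ⌝ᵉ)) ⌜ s ⌝ ⌜ t ⌝ 0 ⌜ xs ⌝ᵉ
      = trans (ok-bind refl refl refl)
          (trans (cong (λ a → u (π ⌜ t ⌝ (π a ⌜ xs ⌝ᵉ))) (table-eval s xs)) (table-eval t (_ ∷ xs)))
    table-eval (rec b s) (x ∷ xs) = iterate x
      where
      i : ℕ → ℕ
      i x = π (code 6 ⌜ b ⌝ ⌜ s ⌝) ⌜ x ∷ xs ⌝ᵉ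
      iterate : ∀ x → u (i x) ≡ ⟦ rec b s ⟧ (u ∘ oracle) (x ∷ xs)
      iterate zero
        with _ , _ , _ , _ , _ , _ , ok-rec , _ ← ok (i 0) (π ⌜ b ⌝ ⌜ xs ⌝ᵉ) 0 ⌜ b ⌝ ⌜ s ⌝ 0 ⌜ xs ⌝ᵉ
        = trans (ok-rec refl refl) (table-eval b xs)
      iterate (suc x)
        with _ , _ , _ , _ , _ , _ , _ , ok-rec , _ ←
               ok (i (suc x)) (i x) (π ⌜ s ⌝ (π x (π (u (i x)) ⌜ xs ⌝ᵉ))) ⌜ b ⌝ ⌜ s ⌝ x ⌜ xs ⌝ᵉ
        = trans (ok-rec refl refl refl)
            (trans (cong (λ a → u (π ⌜ s ⌝ (π x (π a ⌜ xs ⌝ᵉ)))) (iterate x)) (table-eval s (x ∷ _ ∷ xs)))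
    table-eval (ex t) xs = go (E (λ m → ⟦ t ⟧ (u ∘ oracle) (m ∷ xs)) ≟ 0)
      where
      i w : ℕ
      i = π (code 7 ⌜ t ⌝ 0) ⌜ xs ⌝ᵉ
      w = π (code 9 ⌜ t ⌝ 0) ⌜ xs ⌝ᵉ
      hit : u i ≡ 0 → u (π ⌜ t ⌝ (π (u w) ⌜ xs ⌝ᵉ)) ≡ 0
      hit with _ , _ , _ , _ , _ , _ , _ , _ , ok-ex , _ ← ok i w (π ⌜ t ⌝ (π (u w) ⌜ xs ⌝ᵉ)) ⌜ t ⌝ 0 0 ⌜ xs ⌝ᵉ
        = ok-ex refl refl refl
      miss : ∀ m → u i ≡ 0 ⊎ (u i ≡ 1 × ¬ u (π ⌜ t ⌝ (π m ⌜ xs ⌝ᵉ)) ≡ 0)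
      miss m with _ , _ , _ , _ , _ , _ , _ , _ , _ , ok-ex ← ok i (π ⌜ t ⌝ (π m ⌜ xs ⌝ᵉ)) 0 ⌜ t ⌝ 0 m ⌜ xs ⌝ᵉ
        = ok-ex refl refl
      go : Dec (E (λ m → ⟦ t ⟧ (u ∘ oracle) (m ∷ xs)) ≡ 0) → u i ≡ E (λ m → ⟦ t ⟧ (u ∘ oracle) (m ∷ xs))
      go (yes p) with m , q ← to (E⇔ _) p with miss m
      ... | inj₁ r       = trans r (sym p)
      ... | inj₂ (_ , r) = ⊥-elim (r (trans (table-eval t (m ∷ xs)) q))
      go (no ¬p) with miss 0
      ... | inj₂ (r , _) = trans r (sym (E≢0⇒≡1 _ ¬p))
      ... | inj₁ r       = ⊥-elim (¬p (from (E⇔ _) (u w , trans (sym (table-eval t (u w ∷ xs))) (hit r))))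

  -- Every number is read as a syntax tree, so that the clauses also hold at positions that code no term.

  data Tree : Set where
    tip  : Tree
    fork : ℕ → Tree → Tree → Tree

  -- The first argument is fuel. The number itself is enough, since the components of a pair are
  -- smaller than the pair.
  decode : ℕ → ℕ → Tree
  decode _       zero    = tip
  decode zero    (suc _) = tip
  decode (suc k) (suc c) = fork (fst′ (suc c)) (decode k (fst′ (snd′ (suc c)))) (decode k (snd′ (snd′ (suc c))))

  snd′-≤-pred : ∀ {m c} → m ≤ c → snd′ m ≤ c
  snd′-≤-pred {zero}  {c} p = subst (_≤ c) (sym snd′-zero) p
  snd′-≤-pred {suc m} {c} p = ≤-trans (snd′-≤ m) (≤-trans (n≤1+n m) p)

  fst′-≤-pred : ∀ {m c} → m ≤ c → fst′ m ≤ c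
  fst′-≤-pred {zero}  {c} p = subst (_≤ c) (sym fst′-zero) p
  fst′-≤-pred {suc m} {c} p = ≤-trans (fst′-≤ m) (≤-trans (n≤1+n m) p)

  decode-fuel : ∀ k l c → c ≤ k → c ≤ l → decode k c ≡ decode l c
  decode-fuel k       l       zero    _       _       = refl
  decode-fuel (suc k) (suc l) (suc c) (s≤s p) (s≤s q) =
    cong₂ (fork (fst′ (suc c)))
      (decode-fuel k l _ (fst′-≤-pred (≤-trans (snd′-≤ c) p)) (fst′-≤-pred (≤-trans (snd′-≤ c) q)))
      (decode-fuel k l _ (snd′-≤-pred (≤-trans (snd′-≤ c) p)) (snd′-≤-pred (≤-trans (snd′-≤ c) q)))

  tree : ℕ → Tree
  tree c = decode c c

  tree-π : ∀ t p → tree (π t p) ≡ fork t (tree (fst′ p)) (tree (snd′ p))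
  tree-π t p with π t p in eq | a<π t p | b<π t p
  ... | suc m | _ | s≤s p≤m rewrite sym eq | fst′-π t p | snd′-π t p =
    cong₂ (fork t) (decode-fuel m _ _ (fst′-≤-pred p≤m) ≤-refl) (decode-fuel m _ _ (snd′-≤-pred p≤m) ≤-refl)

  tree-code : ∀ t c d → tree (code t c d) ≡ fork t (tree c) (tree d)
  tree-code t c d = trans (tree-π t (π c d)) (cong₂ (λ c d → fork t (tree c) (tree d)) (fst′-π c d) (snd′-π c d))

  witness : (ℕ → ℕ) → ℕ
  witness f with E f ≟ 0
  ... | yes p = proj₁ (to (E⇔ f) p)
  ... | no _  = 0

  witness-correct : ∀ f → E f ≡ 0 → f (witness f) ≡ 0
  witness-correct f p with E f ≟ 0
  ... | yes q = proj₂ (to (E⇔ f) q)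
  ... | no ¬p = ⊥-elim (¬p p)

  module _ (h : Tp 1) where

    run : Tree → ℕ → ℕ
    run tip          e = 0
    run (fork 0 c d) e = 0
    run (fork 1 c d) e = suc (fst′ e)
    run (fork 2 c d) e = fst′ e
    run (fork 3 c d) e = h (fst′ e)
    run (fork 4 c d) e = run c (snd′ e)
    run (fork 5 c d) e = run d (π (run c e) e)
    run (fork 6 c d) e = primRec (run c (snd′ e)) (λ m a → run d (π m (π a (snd′ e)))) (fst′ e)
    run (fork 7 c d) e = E (λ m → run c (π m e))
    run (fork 8 c d) e = h e
    run (fork 9 c d) e = witness (λ m → run c (π m e))
    run (fork _ c d) e = 0

    tableOf : ℕ → ℕ
    tableOf i = run (tree (fst′ i)) (snd′ i)

    tableOf-π : ∀ c e → tableOf (π c e) ≡ run (tree c) e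
    tableOf-π c e = cong₂ (λ c e → run (tree c) e) (fst′-π c e) (snd′-π c e)

    tableOf-code : ∀ t c d e → tableOf (π (code t c d) e) ≡ run (fork t (tree c) (tree d)) e
    tableOf-code t c d e = trans (tableOf-π (code t c d) e) (cong (λ b → run b e) (tree-code t c d))

    tableOf-oracle : ∀ x → tableOf (oracle x) ≡ h x
    tableOf-oracle x = tableOf-code 8 0 0 x

    tableOf-isTable : IsTable tableOf
    tableOf-isTable q₁ a₁ q₂ a₂ q₃ a₃ refl refl refl c d x e =
        (λ { refl → tableOf-code 0 0 0 e })
      , (λ { refl → trans (tableOf-code 1 0 0 _) (cong suc (fst′-π x e)) })
      , (λ { refl → trans (tableOf-code 2 0 0 _) (fst′-π x e) })
      , (λ { refl refl → trans (tableOf-code 3 0 0 _) (trans (cong h (fst′-π x e)) (sym (tableOf-oracle x))) })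
      , (λ { refl refl → trans (tableOf-code 4 c 0 _) (trans (cong (run (tree c)) (snd′-π x e)) (sym (tableOf-π c e))) })
      , (λ { refl refl refl → trans (tableOf-code 5 c d e)
               (trans (cong (λ a → run (tree d) (π a e)) (sym (tableOf-π c e))) (sym (tableOf-π d _))) })
      , (λ { refl refl → trans (rec-eq 0) (sym (tableOf-π c e)) })
      , (λ { refl refl refl → trans (rec-eq (suc x))
               (trans (cong (λ a → run (tree d) (π x (π a e))) (sym (rec-eq x))) (sym (tableOf-π d _))) })
      , (λ { refl refl refl p → trans (tableOf-π c _)
               (trans (cong (λ a → run (tree c) (π a e)) (tableOf-code 9 c 0 e))
                 (witness-correct (λ m → run (tree c) (π m e)) (trans (sym (tableOf-code 7 c 0 e)) p))) })
      , (λ { refl refl → ex-eq })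
      where
      rec-eq : ∀ y → tableOf (π (code 6 c d) (π y e)) ≡ primRec (run (tree c) e) (λ m a → run (tree d) (π m (π a e))) y
      rec-eq y = trans (tableOf-code 6 c d _)
        (cong₂ (λ e y → primRec (run (tree c) e) (λ m a → run (tree d) (π m (π a e))) y) (snd′-π y e) (fst′-π y e))
      ex-eq : tableOf (π (code 7 c 0) e) ≡ 0 ⊎ (tableOf (π (code 7 c 0) e) ≡ 1 × ¬ tableOf (π c (π x e)) ≡ 0)
      ex-eq with E (λ m → run (tree c) (π m e)) ≟ 0
      ... | yes p = inj₁ (trans (tableOf-code 7 c 0 e) p)
      ... | no ¬p = inj₂ (trans (tableOf-code 7 c 0 e) (E≢0⇒≡1 _ ¬p)
                         , λ q → ¬p (from (E⇔ _) (x , trans (sym (tableOf-π c _)) q)))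

  -- The forest of table prefixes.

  _⊏_ : ℕ → ℕ → Set
  a ⊏ b = ∃ λ d → suc (a + d) ≡ b

  <⇒⊏ : ∀ {a b} → a < b → a ⊏ b
  <⇒⊏ p = _ , m+[n∸m]≡n p

  ⊏⇒< : ∀ {a b} → a ⊏ b → a < b
  ⊏⇒< (d , refl) = s≤s (m≤m+n _ d)

  node : ℕ → ℕ → ℕ → ℕ
  node r L p = π r (π L p)

  Entry : ℕ → ℕ → ℕ → ℕ → Set
  Entry L p q a = q ⊏ L × at p q ≡ a

  node-injective : ∀ {r L p r′ L′ p′} → node r L p ≡ node r′ L′ p′ → r ≡ r′ × L ≡ L′ × p ≡ p′
  node-injective eq with refl , eq′ ← π-injective eq with refl , refl ← π-injective eq′ = refl , refl , refl

  -- node r L p is the table prefix of length L listed by p, in search of a table with value 0 at position r.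
  opaque
    _≺_ : ℕ → ℕ → Set
    y ≺ x = ∃ λ r → ∃ λ L → ∃ λ p → ∃ λ L′ → ∃ λ p′ →
        x ≡ node r L p
      × y ≡ node r L′ p′
      × L ⊏ L′
      × (∀ q → q ⊏ L → at p q ≡ at p′ q)
      × (r ⊏ L′ → at p′ r ≡ 0)
      × Table (Entry L′ p′)

    -- A child may be longer by any amount, and the root and table conditions concern the child
    -- alone, so intermediate prefixes can be skipped.
    ≺-trans : ∀ {x y z} → x ≺ y → y ≺ z → x ≺ z
    ≺-trans (r , L , p , L′ , p′ , refl , x≡ , L⊏L′ , agree , root , table)
            (_ , K , o , _ , _ , z≡ , y≡ , K⊏L , agree′ , _)
      with refl , refl , refl ← node-injective y≡
      = r , K , o , L′ , p′ , z≡ , x≡ , <⇒⊏ (<-trans (⊏⇒< K⊏L) (⊏⇒< L⊏L′))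
      , (λ q q⊏K → trans (agree′ q q⊏K) (agree q (<⇒⊏ (<-trans (⊏⇒< q⊏K) (⊏⇒< K⊏L))))) , root , table

    extend : ∀ {r L p L′ p′} → L < L′ → (∀ q → q < L → at p q ≡ at p′ q) → (r < L′ → at p′ r ≡ 0) →
             Table (λ q a → q < L′ × at p′ q ≡ a) → node r L′ p′ ≺ node r L p
    extend L<L′ agree root table = _ , _ , _ , _ , _ , refl , refl
      , <⇒⊏ L<L′ , (λ q → agree q ∘ ⊏⇒<) , root ∘ ⊏⇒<
      , λ q₁ a₁ q₂ a₂ q₃ a₃ (e₁ , f₁) (e₂ , f₂) (e₃ , f₃) →
          table q₁ a₁ q₂ a₂ q₃ a₃ (⊏⇒< e₁ , f₁) (⊏⇒< e₂ , f₂) (⊏⇒< e₃ , f₃)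

    extension : ∀ {y r L p} → y ≺ node r L p → ∃ λ L′ → ∃ λ p′ → y ≡ node r L′ p′ × L < L′
      × (∀ q → q < L → at p q ≡ at p′ q) × (r < L′ → at p′ r ≡ 0) × Table (λ q a → q < L′ × at p′ q ≡ a)
    extension (_ , _ , _ , L′ , p′ , x≡ , y≡ , L⊏L′ , agree , root , table)
      with refl , refl , refl ← node-injective x≡
      = L′ , p′ , y≡ , ⊏⇒< L⊏L′ , (λ q → agree q ∘ <⇒⊏) , root ∘ <⇒⊏
      , λ q₁ a₁ q₂ a₂ q₃ a₃ (e₁ , f₁) (e₂ , f₂) (e₃ , f₃) →
          table q₁ a₁ q₂ a₂ q₃ a₃ (<⇒⊏ e₁ , f₁) (<⇒⊏ e₂ , f₂) (<⇒⊏ e₃ , f₃)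

  _accessible : ℕ → Set
  x accessible = Acc _≺_ x

  inaccessible-child : ∀ {x} → ¬ x accessible → ∃ λ y → y ≺ x × ¬ y accessible
  inaccessible-child {x} ¬ax with em {∃ λ y → y ≺ x × ¬ y accessible}
  ... | yes p = p
  ... | no ¬p = ⊥-elim (¬ax (acc λ {y} y≺x → decidable-stable em λ ¬ay → ¬p (y , y≺x , ¬ay)))

  root : ℕ → ℕ
  root r = node r 0 0

  module _ {u r} (table : IsTable u) (u-root : u r ≡ 0) where

    -- Every node that lists a prefix of `u` has a child that lists a longer one, so the descent
    -- through prefixes never ends.
    initial-inaccessible : ∀ {x} → x accessible → ∀ L p → x ≡ node r L p → (∀ q → q < L → at p q ≡ u q) → ⊥
    initial-inaccessible (acc below) L p refl p≈u =
      initial-inaccessible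
        (below (extend (n<1+n L)
          (λ q q<L → trans (p≈u q q<L) (sym (p′≈u q (m≤n⇒m≤1+n q<L))))
          (λ r< → trans (p′≈u r r<) u-root)
          (λ q₁ a₁ q₂ a₂ q₃ a₃ e₁ e₂ e₃ → table q₁ a₁ q₂ a₂ q₃ a₃ (entry e₁) (entry e₂) (entry e₃))))
        (suc L) p′ refl p′≈u
      where
      p′ = restrict u (suc L)
      p′≈u : ∀ q → q < suc L → at p′ q ≡ u q
      p′≈u q = at-restrict u
      entry : ∀ {q a} → q < suc L × at p′ q ≡ a → u q ≡ a
      entry (q< , eq) = trans (sym (p′≈u _ q<)) eq

  module _ {r : ℕ} (¬a : ¬ root r accessible) where

    private
      State : Set
      State = ∃ λ L → ∃ λ p → ¬ node r L p accessible

      len : State → ℕ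
      len = proj₁

      val : State → ℕ → ℕ
      val (_ , p , _) = at p

      Next : State → State → Set
      Next s t = len s < len t × (∀ q → q < len s → val s q ≡ val t q)
               × (r < len t → val t r ≡ 0) × Table (λ q a → q < len t × val t q ≡ a)

      next : ∀ s → ∃ (Next s)
      next (L , p , ¬aL) with y , y≺x , ¬ay ← inaccessible-child ¬aL with L′ , p′ , refl , step ← extension y≺x
        = (L′ , p′ , ¬ay) , step

      chain : ℕ → State
      -- The chain begins with a child, because the table conditions are known only for nodes
      -- reached by a step.
      chain zero    = proj₁ (next (0 , 0 , ¬a))
      chain (suc m) = proj₁ (next (chain m))

      chain-next : ∀ m → Next (chain m) (chain (suc m))
      chain-next m = proj₂ (next (chain m))

      chain-ok : ∀ m → (r < len (chain m) → val (chain m) r ≡ 0) × Table (λ q a → q < len (chain m) × val (chain m) q ≡ a)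
      chain-ok zero    = proj₂ (proj₂ (proj₂ (next (0 , 0 , ¬a))))
      chain-ok (suc m) = proj₂ (proj₂ (chain-next m))

      m<len : ∀ m → m < len (chain m)
      m<len zero    = proj₁ (proj₂ (next (0 , 0 , ¬a)))
      m<len (suc m) = ≤-trans (s≤s (m<len m)) (proj₁ (chain-next m))

      limit : ℕ → ℕ
      limit q = val (chain q) q

      stays : ∀ q d → q < len (chain (d + q)) × val (chain (d + q)) q ≡ limit q
      stays q zero    = m<len q , refl
      stays q (suc d) with q< , eq ← stays q d =
        <-trans q< (proj₁ (chain-next (d + q))) , trans (sym (proj₁ (proj₂ (chain-next (d + q))) q q<)) eq

      stays-≤ : ∀ {q m} → q ≤ m → q < len (chain m) × val (chain m) q ≡ limit q
      stays-≤ {q} {m} q≤m = subst (λ m → q < len (chain m) × val (chain m) q ≡ limit q) (m∸n+n≡m q≤m) (stays q (m ∸ q))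

    -- Position q is settled from stage q on. A clause involves three positions, so it is inherited
    -- from one stage at which all three are settled.
    limit-table : ∃ λ u → IsTable u × u r ≡ 0
    limit-table = limit
      , (λ q₁ a₁ q₂ a₂ q₃ a₃ e₁ e₂ e₃ →
           let m = q₁ ⊔ q₂ ⊔ q₃
               entry : ∀ {q a} → q ≤ m → limit q ≡ a → q < len (chain m) × val (chain m) q ≡ a
               entry = λ q≤m e → let q< , eq = stays-≤ q≤m in q< , trans eq e
           in proj₂ (chain-ok m) q₁ a₁ q₂ a₂ q₃ a₃
                (entry (≤-trans (m≤m⊔n q₁ q₂) (m≤m⊔n _ q₃)) e₁)
                (entry (≤-trans (m≤n⊔m q₁ q₂) (m≤m⊔n _ q₃)) e₂)
                (entry (m≤n⊔m (q₁ ⊔ q₂) q₃) e₃))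
      , proj₁ (chain-ok r) (m<len r)

  inaccessible⇔table : ∀ r → (¬ root r accessible) ⇔ (∃ λ u → IsTable u × u r ≡ 0)
  inaccessible⇔table r = mk⇔ limit-table
    (λ (u , table , u-root) a → initial-inaccessible table u-root a 0 0 refl (λ _ ()))

  -- A universal Σ¹₁ set.

  inst : ℕ → ℕ → ℕ
  inst c v = root (π c (π v 0))

  constᶜ : ℕ → Core n
  constᶜ zero    = zer
  constᶜ (suc m) = bind (constᶜ m) sc

  constᶜ-correct : ∀ m (h : Tp 1) (xs : Vec ℕ n) → ⟦ constᶜ m ⟧ h xs ≡ m
  constᶜ-correct zero    h xs = refl
  constᶜ-correct (suc m) h xs = cong suc (constᶜ-correct m h xs)

  section : ℕ → Core (suc n)
  section j = bind (πᶜ (constᶜ j) hd) orc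

  section-correct : ∀ j h x (xs : Vec ℕ n) → ⟦ section j ⟧ h (x ∷ xs) ≡ h (π j x)
  section-correct j h x xs = cong h
    (trans (πᶜ-correct h (x ∷ xs) (constᶜ j) hd) (cong (λ j → π j x) (constᶜ-correct j h (x ∷ xs))))

  component : Vec (Tp 1) k → ℕ → Tp 1
  component []       _       = λ _ → 0
  component (g ∷ gs) zero    = g
  component (g ∷ gs) (suc j) = component gs j

  merge : Vec (Tp 1) k → Tp 1
  merge gs i = component gs (fst′ i) (snd′ i)

  merge-π : ∀ (gs : Vec (Tp 1) k) i x → merge gs (π (toℕ i) x) ≡ lookup gs i x
  merge-π gs i x = trans (cong₂ (component gs) (fst′-π _ x) (snd′-π (toℕ i) x)) (go gs i)
    where
    go : ∀ {k} (gs : Vec (Tp 1) k) i → component gs (toℕ i) x ≡ lookup gs i x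
    go (g ∷ gs) zero    = refl
    go (g ∷ gs) (suc i) = go gs i

  module _ (Ψ : Formula 2 3) (φ : Formula k 2) where

    private
      ρΨ : Functions 2
      ρΨ zero       = ATᶜ
      ρΨ (suc zero) = section 0

      ρφ : Functions k
      ρφ i = section (suc (toℕ i))

      θ : Fin 2 → Fin 3
      θ zero       = zero
      θ (suc zero) = suc zero

      matrix : Core 1
      matrix = ex (ex (formula ρΨ id Ψ ∧ᶜ formula ρφ θ φ))

      Satisfied : ℕ → Tp 1 → Vec (Tp 1) k → Set
      Satisfied v Z hs = ∃ λ b → ∃ λ i → Sat Ψ (AT ∷ Z ∷ []) (i ∷ b ∷ v ∷ []) × Sat φ hs (i ∷ b ∷ [])

      matrix-correct : ∀ {h Z hs v} → (∀ x → h (π 0 x) ≡ Z x) → (∀ i x → h (π (suc (toℕ i)) x) ≡ lookup hs i x) →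
                       True (⟦ matrix ⟧ h (v ∷ [])) ⇔ Satisfied v Z hs
      matrix-correct {h} {Z} {hs} h≈Z h≈hs = ∃-true λ b → ∃-true λ i → ∧-true
        (formula-correct dΨ (λ _ → refl) Ψ)
        (formula-correct dφ (λ { zero → refl ; (suc zero) → refl }) φ)
        where
        dΨ : Denotes ρΨ h (AT ∷ Z ∷ [])
        dΨ zero       x xs = ATᶜ-correct h x xs
        dΨ (suc zero) x xs = trans (section-correct 0 h x xs) (h≈Z x)
        dφ : Denotes ρφ h hs
        dφ i x xs = trans (section-correct (suc (toℕ i)) h x xs) (h≈hs i x)

    opaque
      -- `matrix` becomes a coded term whose oracle carries `Z` and `hs` as columns, and `inst c v`
      -- searches for a table in which its value at v is 0. If `φ` defines the graph of g, then b is
      -- the value g i, so `Ψ` may use g both positively and negatively.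
      universal : ∃ λ c → ∀ v → (¬ inst c v accessible) ⇔ (∃ λ Z → ∃ λ hs → Satisfied v Z hs)
      universal = ⌜ matrix ⌝ , λ v → ⇔-trans (inaccessible⇔table _) (mk⇔
        (λ (u , table , u-root) → let h = u ∘ oracle in
          (h ∘ π 0) , tabulate (λ i x → h (π (suc (toℕ i)) x))
          , to (matrix-correct (λ _ → refl)
                 (λ i x → sym (cong (λ g → g x) (lookup∘tabulate (λ i x → h (π (suc (toℕ i)) x)) i))))
              (trans (sym (table-eval table matrix (v ∷ []))) u-root))
        (λ (Z , hs , sat) → let h = merge (Z ∷ hs) in
          tableOf h , tableOf-isTable h
          , trans (table-eval (tableOf-isTable h) matrix (v ∷ []))
              (from (matrix-correct
                      (λ x → trans (tableOf-oracle h (π 0 x)) (merge-π (Z ∷ hs) zero x))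
                      (λ i x → trans (tableOf-oracle h (π (suc (toℕ i)) x)) (merge-π (Z ∷ hs) (suc i) x)))
                 sat)))

  -- Arithmetical formulas for the forest.

  ≡⇒⇔ : {P Q : Set} → P ≡ Q → P ⇔ Q
  ≡⇒⇔ refl = mk⇔ id id

  ∀-cong : {P Q : ℕ → Set} → (∀ x → P x ⇔ Q x) → (∀ x → P x) ⇔ (∀ x → Q x)
  ∀-cong P⇔Q = mk⇔ (λ p x → to (P⇔Q x) (p x)) (λ q x → from (P⇔Q x) (q x))

  ∃-cong : {P Q : ℕ → Set} → (∀ x → P x ⇔ Q x) → ∃ P ⇔ ∃ Q
  ∃-cong P⇔Q = mk⇔ (λ (x , p) → x , to (P⇔Q x) p) (λ (x , q) → x , from (P⇔Q x) q)

  -- In all formulas below, the function variable 0 denotes AT.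

  fin : ∀ m {n} → Fin (suc (m + n))
  fin zero    = zero
  fin (suc m) = suc (fin m)

  # : ∀ m {k n} → Term k (suc (m + n))
  # m = var (fin m)

  num : ℕ → Term k n
  num zero    = `0
  num (suc m) = `S (num m)

  πᵗ : Term k n → Term k n → Term k n
  πᵗ s t = `S (((s `+ t) `* (s `+ t)) `+ s)

  codeᵗ : ℕ → Term k n → Term k n → Term k n
  codeᵗ t c d = πᵗ (num t) (πᵗ c d)

  _⊏ᶠ_ : Fin n → Fin n → Formula k n
  i ⊏ᶠ j = `∃ (`S (var (suc i) `+ # 0) `≡ var (suc j))

  atᵗ : Term (suc k) n → Term (suc k) n → Term (suc k) n
  atᵗ p q = app zero (πᵗ p q)

  okᶠ : Formula k (6 + n)
  okᶠ {k} {n} = `∀ (`∀ (`∀ (`∀ (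
      ((q₁ `≡ πᵗ (codeᵗ 0 `0 `0) e) `→ (a₁ `≡ `0))
    `∧ (((q₁ `≡ πᵗ (codeᵗ 1 `0 `0) (πᵗ x e)) `→ (a₁ `≡ `S x))
    `∧ (((q₁ `≡ πᵗ (codeᵗ 2 `0 `0) (πᵗ x e)) `→ (a₁ `≡ x))
    `∧ (((q₁ `≡ πᵗ (codeᵗ 3 `0 `0) (πᵗ x e)) `→ ((q₂ `≡ πᵗ (codeᵗ 8 `0 `0) x) `→ (a₁ `≡ a₂)))
    `∧ (((q₁ `≡ πᵗ (codeᵗ 4 c `0) (πᵗ x e)) `→ ((q₂ `≡ πᵗ c e) `→ (a₁ `≡ a₂)))
    `∧ (((q₁ `≡ πᵗ (codeᵗ 5 c d) e) `→ ((q₂ `≡ πᵗ c e) `→ ((q₃ `≡ πᵗ d (πᵗ a₂ e)) `→ (a₁ `≡ a₃))))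
    `∧ (((q₁ `≡ πᵗ (codeᵗ 6 c d) (πᵗ `0 e)) `→ ((q₂ `≡ πᵗ c e) `→ (a₁ `≡ a₂)))
    `∧ (((q₁ `≡ πᵗ (codeᵗ 6 c d) (πᵗ (`S x) e)) `→ ((q₂ `≡ πᵗ (codeᵗ 6 c d) (πᵗ x e)) `→
          ((q₃ `≡ πᵗ d (πᵗ x (πᵗ a₂ e))) `→ (a₁ `≡ a₃))))
    `∧ (((q₁ `≡ πᵗ (codeᵗ 7 c `0) e) `→ ((q₂ `≡ πᵗ (codeᵗ 9 c `0) e) `→
          ((q₃ `≡ πᵗ c (πᵗ a₂ e)) `→ ((a₁ `≡ `0) `→ (a₃ `≡ `0)))))
    `∧ ((q₁ `≡ πᵗ (codeᵗ 7 c `0) e) `→ ((q₂ `≡ πᵗ c (πᵗ x e)) `→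
          ((a₁ `≡ `0) `∨ ((a₁ `≡ `S `0) `∧ (`¬ (a₂ `≡ `0))))))))))))))))))
    where
    e x d c a₃ q₃ a₂ q₂ a₁ q₁ : Term k (10 + n)
    e  = # 0
    x  = # 1
    d  = # 2
    c  = # 3
    a₃ = # 4
    q₃ = # 5
    a₂ = # 6
    q₂ = # 7
    a₁ = # 8
    q₁ = # 9

  entryᶠ : (L p q a : Fin n) → Formula (suc k) n
  entryᶠ L p q a = (q ⊏ᶠ L) `∧ (atᵗ (var p) (var q) `≡ var a)

  tableᶠ : (L p : Fin n) → Formula (suc k) n
  tableᶠ L p = `∀ (`∀ (`∀ (`∀ (`∀ (`∀ (
    entryᶠ L′ p′ (fin 5) (fin 4) `→ (entryᶠ L′ p′ (fin 3) (fin 2) `→ (entryᶠ L′ p′ (fin 1) (fin 0) `→ okᶠ))))))))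
    where
    L′ = suc (suc (suc (suc (suc (suc L)))))
    p′ = suc (suc (suc (suc (suc (suc p)))))

  opaque
    unfolding π _≺_

    _≺ᶠ_ : Fin n → Fin n → Formula (suc k) n
    _≺ᶠ_ {n} i j = `∃ (`∃ (`∃ (`∃ (`∃ (
        (var j′ `≡ πᵗ (# 4) (πᵗ (# 3) (# 2)))
      `∧ ((var i′ `≡ πᵗ (# 4) (πᵗ (# 1) (# 0)))
      `∧ ((fin 3 ⊏ᶠ fin 1)
      `∧ ((`∀ ((fin 0 ⊏ᶠ fin 4) `→ (atᵗ (# 3) (# 0) `≡ atᵗ (# 1) (# 0))))
      `∧ (((fin 4 ⊏ᶠ fin 1) `→ (atᵗ (# 0) (# 4) `≡ `0))
      `∧ tableᶠ (fin 1) (fin 0))))))))))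
      where
      i′ j′ : Fin (5 + n)
      i′ = suc (suc (suc (suc (suc i))))
      j′ = suc (suc (suc (suc (suc j))))

    -- `_≺_` is written in the shape that `Sat` unfolds to, with `_⊏_` in place of `_<_`, so the two
    -- sides coincide definitionally.
    ≺ᶠ-correct : ∀ (i j : Fin n) {hs : Vec (Tp 1) k} {xs} → Sat (i ≺ᶠ j) (AT ∷ hs) xs ⇔ lookup xs i ≺ lookup xs j
    ≺ᶠ-correct i j = ≡⇒⇔ refl

  -- Local conditions on rank comparisons.

  -- H (π s t) = 0 reads "the rank of t is at most the rank of s".

  Zero : Tp 1 → ℕ → ℕ → Set
  Zero H s t = H (π s t) ≡ 0

  Below : Tp 1 → ℕ → ℕ → Set
  Below H s t = ∀ t′ → t′ ≺ t → ∃ λ s′ → s′ ≺ s × Zero H s′ t′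

  Correct : Tp 1 → ℕ → ℕ → Set
  Correct H s t = (Zero H s t → Below H s t) × (Below H s t → Zero H s t)

  -- One half of `Correct`, at all pairs. Functions with this property witness rank inequalities,
  -- which makes `_⊵_` Σ¹₁.
  Simulation : Tp 1 → Set
  Simulation Z = ∀ s t → Zero Z s t → Below Z s t

  -- The second clause holds for every H if e is accessible.  If e is not, it makes the accessible nodes below e
  -- cofinal in rank among all accessible nodes.
  PseudoRank : Tp 1 → ℕ → Set
  PseudoRank H e =
      (∀ σ → σ ≺ e → ∀ x → Correct H σ x)
    × (∀ τ x → τ ≺ e → Zero H τ x →
         ∃ λ σ → (σ ≺ τ ⊎ σ ≡ τ) × Zero H σ x × (∀ σ′ → σ′ ≺ σ → ¬ Zero H σ′ x))

  -- `Correct g σ x` depends on g only at `π σ x` and at pairs whose first component is below σ;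
  -- hence minimality in σ alone.
  Fault : Tp 1 → ℕ → ℕ → Set
  Fault g e i = ∃ λ σ → ∃ λ x → i ≡ π σ x × σ ≺ e × (¬ Correct g σ x) × (∀ σ′ → σ′ ≺ σ → ∀ x′ → Correct g σ′ x′)

  zeroᶠ : Term (2 + k) n → Term (2 + k) n → Formula (2 + k) n
  zeroᶠ s t = app (suc zero) (πᵗ s t) `≡ `0

  belowᶠ correctᶠ : Fin n → Fin n → Formula 2 n
  belowᶠ s t = `∀ ((fin 0 ≺ᶠ suc t) `→ (`∃ ((fin 0 ≺ᶠ suc (suc s)) `∧ zeroᶠ (# 0) (# 1))))
  correctᶠ s t = (zeroᶠ (var s) (var t) `→ belowᶠ s t) `∧ (belowᶠ s t `→ zeroᶠ (var s) (var t))

  pseudoRankᶠ : Formula 2 (1 + n)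
  pseudoRankᶠ =
      (`∀ ((fin 0 ≺ᶠ fin 1) `→ (`∀ (correctᶠ (fin 1) (fin 0)))))
    `∧ (`∀ (`∀ ((fin 1 ≺ᶠ fin 2) `→ (zeroᶠ (# 1) (# 0) `→
         (`∃ (((fin 0 ≺ᶠ fin 2) `∨ (# 0 `≡ # 2)) `∧ (zeroᶠ (# 0) (# 1)
            `∧ (`∀ ((fin 0 ≺ᶠ fin 1) `→ (`¬ zeroᶠ (# 0) (# 2)))))))))))

  instᵗ : Term k n → Term k n → Term k n
  instᵗ c v = πᵗ (πᵗ c (πᵗ v `0)) (πᵗ `0 `0)

  num-correct : ∀ m {hs : Vec (Tp 1) k} {xs : Vec ℕ n} → evalTerm (num m) hs xs ≡ m
  num-correct zero    = refl
  num-correct (suc m) = cong suc (num-correct m)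

  -- To be read with b = g i: for some σ, g is nonzero at `π σ x`, and `Z` witnesses `x ⊵ y`. The
  -- variable c′ confines the numeral `num c`, which equals c only propositionally, to a single
  -- equation.
  Dominated : ℕ → Tp 1 → ℕ → ℕ → ℕ → Set
  Dominated c Z i b v = ∃ λ x → ∃ λ σ → ∃ λ y → ∃ λ c′ →
    c′ ≡ c × y ≡ inst v v × i ≡ π σ x × x ≡ inst c′ (π c′ σ) × (¬ b ≡ 0) × Zero Z x y × Simulation Z

  -- The free variables are i, b and v in the first three formulas, e and i in the last.

  opaque
    rankableᶠ : Formula 2 3
    rankableᶠ = `∃ ((# 0 `≡ instᵗ (# 3) (# 3)) `∧ pseudoRankᶠ)

    diagonalᶠ : Formula 2 3
    diagonalᶠ = `∃ (`∃ ((# 4 `≡ πᵗ (# 1) (# 0)) `∧ ((# 2 `≡ πᵗ (# 0) (instᵗ (# 1) (# 4))) `∧ (# 3 `≡ `0))))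

    dominatedᶠ : ℕ → Formula 2 3
    dominatedᶠ c = `∃ (`∃ (`∃ (`∃ (
        (# 0 `≡ num c)
      `∧ ((# 1 `≡ instᵗ (# 6) (# 6))
      `∧ ((# 4 `≡ πᵗ (# 2) (# 3))
      `∧ ((# 3 `≡ instᵗ (# 0) (πᵗ (# 0) (# 2)))
      `∧ ((`¬ (# 5 `≡ `0))
      `∧ (zeroᶠ (# 3) (# 1)
      `∧ (`∀ (`∀ (zeroᶠ (# 1) (# 0) `→ belowᶠ (fin 1) (fin 0)))))))))))))

    faultᶠ : Formula 2 2
    faultᶠ = `∃ (`∃ ((# 3 `≡ πᵗ (# 1) (# 0)) `∧ ((fin 1 ≺ᶠ fin 2) `∧ ((`¬ correctᶠ (fin 1) (fin 0))
              `∧ (`∀ ((fin 0 ≺ᶠ fin 2) `→ (`∀ correctᶠ (fin 1) (fin 0))))))))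

  module _ {H : Tp 1} {xs : Vec ℕ n} where
    opaque
      unfolding π

      belowᶠ-correct : ∀ s t → Sat (belowᶠ s t) (AT ∷ H ∷ []) xs ⇔ Below H (lookup xs s) (lookup xs t)
      belowᶠ-correct s t = ∀-cong λ _ → →-cong-⇔ (≺ᶠ-correct zero (suc t))
        (∃-cong λ _ → ≺ᶠ-correct zero (suc (suc s)) ×-⇔ ⇔-refl)

      correctᶠ-correct : ∀ s t → Sat (correctᶠ s t) (AT ∷ H ∷ []) xs ⇔ Correct H (lookup xs s) (lookup xs t)
      correctᶠ-correct s t =
        →-cong-⇔ ⇔-refl (belowᶠ-correct s t) ×-⇔ →-cong-⇔ (belowᶠ-correct s t) ⇔-refl

  module _ {H : Tp 1} where
    opaque
      unfolding π rankableᶠ diagonalᶠ dominatedᶠ faultᶠ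

      pseudoRankᶠ-correct : ∀ {e} {xs : Vec ℕ n} → Sat pseudoRankᶠ (AT ∷ H ∷ []) (e ∷ xs) ⇔ PseudoRank H e
      pseudoRankᶠ-correct =
             (∀-cong λ _ → →-cong-⇔ (≺ᶠ-correct (fin 0) (fin 1)) (∀-cong λ _ → correctᶠ-correct (fin 1) (fin 0)))
        ×-⇔ (∀-cong λ _ → ∀-cong λ _ → →-cong-⇔ (≺ᶠ-correct (fin 1) (fin 2)) (→-cong-⇔ ⇔-refl
               (∃-cong λ _ → (≺ᶠ-correct (fin 0) (fin 2) ⊎-⇔ ⇔-refl) ×-⇔ (⇔-refl
                 ×-⇔ (∀-cong λ _ → →-cong-⇔ (≺ᶠ-correct (fin 0) (fin 1)) ⇔-refl)))))

      rankableᶠ-correct : ∀ {i b v} → Sat rankableᶠ (AT ∷ H ∷ []) (i ∷ b ∷ v ∷ []) ⇔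
        (∃ λ y → y ≡ inst v v × PseudoRank H y)
      rankableᶠ-correct = ∃-cong λ _ → ⇔-refl ×-⇔ pseudoRankᶠ-correct

      diagonalᶠ-correct : ∀ {i b v} → Sat diagonalᶠ (AT ∷ H ∷ []) (i ∷ b ∷ v ∷ []) ⇔
        (∃ λ c → ∃ λ σ → v ≡ π c σ × i ≡ π σ (inst c v) × b ≡ 0)
      diagonalᶠ-correct = ≡⇒⇔ refl

      dominatedᶠ-correct : ∀ {i b v} c → Sat (dominatedᶠ c) (AT ∷ H ∷ []) (i ∷ b ∷ v ∷ []) ⇔ Dominated c H i b v
      dominatedᶠ-correct c = ∃-cong λ _ → ∃-cong λ _ → ∃-cong λ _ → ∃-cong λ c′ →
        ≡⇒⇔ (cong (c′ ≡_) (num-correct c)) ×-⇔ (⇔-refl ×-⇔ (⇔-refl ×-⇔ (⇔-refl ×-⇔ (⇔-refl ×-⇔ (⇔-refl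
          ×-⇔ (∀-cong λ _ → ∀-cong λ _ → →-cong-⇔ ⇔-refl (belowᶠ-correct (fin 1) (fin 0))))))))

      faultᶠ-correct : ∀ {e i} → Sat faultᶠ (AT ∷ H ∷ []) (e ∷ i ∷ []) ⇔ Fault H e i
      faultᶠ-correct = ∃-cong λ _ → ∃-cong λ _ → ⇔-refl ×-⇔ (≺ᶠ-correct (fin 1) (fin 2)
        ×-⇔ (¬-cong-⇔ (correctᶠ-correct (fin 1) (fin 0))
        ×-⇔ (∀-cong λ _ → →-cong-⇔ (≺ᶠ-correct (fin 0) (fin 2)) (∀-cong λ _ → correctᶠ-correct (fin 1) (fin 0)))))

  -- The largest simulation, which compares ranks on accessible nodes.

  _⊵_ : ℕ → ℕ → Set
  s ⊵ t = ∃ λ Z → Simulation Z × Zero Z s t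

  characteristic : (ℕ → ℕ → Set) → Tp 1
  characteristic R i with em {∃ λ s → ∃ λ t → i ≡ π s t × R s t}
  ... | yes _ = 0
  ... | no  _ = 1

  characteristic-correct : ∀ {R s t} → Zero (characteristic R) s t ⇔ R s t
  characteristic-correct {R} {s} {t} with em {∃ λ s′ → ∃ λ t′ → π s t ≡ π s′ t′ × R s′ t′}
  ... | yes (_ , _ , eq , r) with refl , refl ← π-injective eq = mk⇔ (λ _ → r) (λ _ → refl)
  ... | no ¬p = mk⇔ (λ ()) (λ r → ⊥-elim (¬p (s , t , refl , r)))

  ⊵-coinduction : (R : ℕ → ℕ → Set) → (∀ s t → R s t → ∀ t′ → t′ ≺ t → ∃ λ s′ → s′ ≺ s × R s′ t′) →
                  ∀ {s t} → R s t → s ⊵ t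
  ⊵-coinduction R simulates r = characteristic R
    , (λ s t z t′ t′≺t → let s′ , s′≺s , r′ = simulates s t (to characteristic-correct z) t′ t′≺t
                         in s′ , s′≺s , from characteristic-correct r′)
    , from characteristic-correct r

  ⊵-unfold : ∀ {s t} → s ⊵ t → ∀ t′ → t′ ≺ t → ∃ λ s′ → s′ ≺ s × s′ ⊵ t′
  ⊵-unfold (Z , sim , z) t′ t′≺t = let s′ , s′≺s , z′ = sim _ _ z t′ t′≺t in s′ , s′≺s , Z , sim , z′

  -- Under the hypothesis, the largest simulation stays a simulation when the pair of s and t is
  -- added.
  ⊵-fold : ∀ {s t} → (∀ t′ → t′ ≺ t → ∃ λ s′ → s′ ≺ s × s′ ⊵ t′) → s ⊵ t
  ⊵-fold {s} {t} below = ⊵-coinduction R simulates (inj₂ (refl , refl))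
    where
    R : ℕ → ℕ → Set
    R a b = a ⊵ b ⊎ (a ≡ s × b ≡ t)
    simulates : ∀ a b → R a b → ∀ b′ → b′ ≺ b → ∃ λ a′ → a′ ≺ a × R a′ b′
    simulates a b (inj₁ a⊵b) b′ b′≺b = let a′ , a′≺a , p = ⊵-unfold a⊵b b′ b′≺b in a′ , a′≺a , inj₁ p
    simulates a b (inj₂ (refl , refl)) b′ b′≺b = let a′ , a′≺a , p = below b′ b′≺b in a′ , a′≺a , inj₁ p

  ⊵-trans : ∀ {s t w} → s ⊵ t → t ⊵ w → s ⊵ w
  ⊵-trans s⊵t t⊵w = ⊵-coinduction (λ a b → ∃ λ m → a ⊵ m × m ⊵ b)
    (λ { a b (m , a⊵m , m⊵b) b′ b′≺b →
           let m′ , m′≺m , m′⊵b′ = ⊵-unfold m⊵b b′ b′≺b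
               a′ , a′≺a , a′⊵m′ = ⊵-unfold a⊵m m′ m′≺m
           in a′ , a′≺a , m′ , a′⊵m′ , m′⊵b′ })
    (_ , s⊵t , t⊵w)

  ⊵-accessible : ∀ {s t} → s accessible → s ⊵ t → t accessible
  ⊵-accessible (acc below) s⊵t = acc λ {t′} t′≺t →
    let s′ , s′≺s , s′⊵t′ = ⊵-unfold s⊵t t′ t′≺t in ⊵-accessible (below s′≺s) s′⊵t′

  -- If some t′ below t is dominated by no node below s, then by induction t′ dominates all of these
  -- nodes, and hence t dominates s.
  ⊵-total : ∀ {s} → s accessible → ∀ t → s ⊵ t ⊎ t ⊵ s
  ⊵-total {s} (acc below) t with em {∃ λ t′ → t′ ≺ t × (∀ s′ → s′ ≺ s → ¬ s′ ⊵ t′)}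
  ... | yes (t′ , t′≺t , p) = inj₂ (⊵-fold λ s′ s′≺s → t′ , t′≺t ,
          [ (λ s′⊵t′ → ⊥-elim (p s′ s′≺s s′⊵t′)) , id ] (⊵-total (below s′≺s) t′))
  ... | no ¬p = inj₁ (⊵-fold λ t′ t′≺t → decidable-stable em λ ¬q → ¬p (t′ , t′≺t , λ s′ s′≺s s′⊵t′ → ¬q (s′ , s′≺s , s′⊵t′)))

  -- The local condition expresses the row of σ through the rows below σ, so induction on
  -- accessibility leaves only `_⊵_`. The uses differ in the downward closed domain `D` on which g
  -- is correct.
  correct-unique : (D : ℕ → Set) → (∀ {σ σ′} → D σ → σ′ ≺ σ → D σ′) →
    ∀ {g} → (∀ {σ} → D σ → ∀ x → Correct g σ x) →
    ∀ {σ} → σ accessible → D σ → ∀ x → Zero g σ x ⇔ σ ⊵ x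
  correct-unique D down {g} correct {σ} (acc below) dσ x = mk⇔
    (λ z → ⊵-fold λ x′ x′≺x → let σ′ , σ′≺σ , z′ = proj₁ (correct dσ x) z x′ x′≺x
                               in σ′ , σ′≺σ , to (IH σ′≺σ x′) z′)
    (λ d → proj₂ (correct dσ x) λ x′ x′≺x → let σ′ , σ′≺σ , d′ = ⊵-unfold d x′ x′≺x
                                             in σ′ , σ′≺σ , from (IH σ′≺σ x′) d′)
    where
    IH : ∀ {σ′} → σ′ ≺ σ → ∀ x → Zero g σ′ x ⇔ σ′ ⊵ x
    IH σ′≺σ = correct-unique D down {g} correct (below σ′≺σ) (down dσ σ′≺σ)

  -- `_⊵_` is locally correct everywhere, by folding and unfolding. A minimal σ is found by
  -- descending from τ while the value stays 0.
  accessible⇒pseudoRank : ∀ {e} → e accessible → ∃ λ H → PseudoRank H e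
  accessible⇒pseudoRank {e} (acc below-e) = H , (λ σ _ x → correct σ x) , λ τ x τ≺e → minimal (below-e τ≺e) x
    where
    H : Tp 1
    H = characteristic _⊵_
    correct : ∀ σ x → Correct H σ x
    correct σ x =
        (λ z x′ x′≺x → let σ′ , σ′≺σ , d = ⊵-unfold (to characteristic-correct z) x′ x′≺x
                       in σ′ , σ′≺σ , from characteristic-correct d)
      , (λ b → from characteristic-correct (⊵-fold λ x′ x′≺x →
           let σ′ , σ′≺σ , z = b x′ x′≺x in σ′ , σ′≺σ , to characteristic-correct z))
    minimal : ∀ {τ} → τ accessible → ∀ x → Zero H τ x →
              ∃ λ σ → (σ ≺ τ ⊎ σ ≡ τ) × Zero H σ x × (∀ σ′ → σ′ ≺ σ → ¬ Zero H σ′ x)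
    minimal {τ} (acc below) x z with em {∃ λ τ′ → τ′ ≺ τ × Zero H τ′ x}
    ... | no ¬p = τ , inj₂ refl , z , λ σ′ σ′≺τ z′ → ¬p (σ′ , σ′≺τ , z′)
    ... | yes (τ′ , τ′≺τ , z′) with minimal (below τ′≺τ) x z′
    ...   | σ , inj₁ σ≺τ′ , rest = σ , inj₁ (≺-trans σ≺τ′ τ′≺τ) , rest
    ...   | σ , inj₂ refl , rest = σ , inj₁ τ′≺τ , rest

  below-map : ∀ {H g σ x} → (∀ {σ′} → σ′ ≺ σ → ∀ x′ → Zero H σ′ x′ → Zero g σ′ x′) → Below H σ x → Below g σ x
  below-map f b x′ x′≺x = let σ′ , σ′≺σ , z = b x′ x′≺x in σ′ , σ′≺σ , f σ′≺σ x′ z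

  -- The diagonal instance of rankability: were it accessible, it would be rankable, hence inaccessible.
  pseudo-accessible : ∃ λ e → (¬ e accessible) × ∃ λ H → PseudoRank H e
  pseudo-accessible = e , ¬ae , rank
    where
    c : ℕ
    c = proj₁ (universal {0} rankableᶠ (`0 `≡ `0))
    e : ℕ
    e = inst c c
    spec = proj₂ (universal {0} rankableᶠ (`0 `≡ `0)) c
    ¬ae : ¬ e accessible
    ¬ae ae = let H , ranks = accessible⇒pseudoRank ae in
      from spec (H , [] , 0 , 0 , from (rankableᶠ-correct {H}) (e , refl , ranks) , refl) ae
    rank : ∃ λ H → PseudoRank H e
    rank with H , _ , b , i , sat , _ ← to spec ¬ae with _ , refl , ranks ← to (rankableᶠ-correct {H}) sat = H , ranks

  -- Hyperarithmetical functions below a pseudo-ranked node.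

  module _ (e : ℕ) (H : Tp 1) (ranks : PseudoRank H e) where

    private
      correct = proj₁ ranks

    rank-unique : ∀ {σ} → σ accessible → σ ≺ e → ∀ x → Zero H σ x ⇔ σ ⊵ x
    rank-unique = correct-unique (_≺ e) (λ σ≺e σ′≺σ → ≺-trans σ′≺σ σ≺e) {H} (λ σ≺e → correct _ σ≺e)

    -- An inaccessible σ acts as if its rank were infinite: by induction on x, an inaccessible child
    -- of σ answers every x′ below x.
    inaccessible-zero : ∀ {x} → x accessible → ∀ {σ} → σ ≺ e → ¬ σ accessible → Zero H σ x
    inaccessible-zero {x} (acc below) {σ} σ≺e ¬aσ = proj₂ (correct σ σ≺e x) λ x′ x′≺x →
      let σ′ , σ′≺σ , ¬aσ′ = inaccessible-child ¬aσ
      in σ′ , σ′≺σ , inaccessible-zero (below x′≺x) (≺-trans σ′≺σ σ≺e) ¬aσ′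

    -- `Zero H τ x` holds since τ is inaccessible, so minimality yields a σ at or below τ. An
    -- inaccessible child of σ would have value 0 too, so σ is accessible and differs from τ.
    cofinal : ∀ {x} → x accessible → ∀ {τ} → τ ≺ e → ¬ τ accessible → ∃ λ σ → σ ≺ τ × σ accessible × σ ⊵ x
    cofinal {x} ax {τ} τ≺e ¬aτ with proj₂ ranks τ x τ≺e (inaccessible-zero ax τ≺e ¬aτ)
    ... | σ , σ≼τ , z , least = place σ≼τ
      where
      below-e : σ ≺ τ ⊎ σ ≡ τ → σ ≺ e
      below-e (inj₁ σ≺τ)  = ≺-trans σ≺τ τ≺e
      below-e (inj₂ refl) = τ≺e
      aσ : σ accessible
      aσ = acc λ {σ′} σ′≺σ → decidable-stable em λ ¬aσ′ →
        least σ′ σ′≺σ (inaccessible-zero ax (≺-trans σ′≺σ (below-e σ≼τ)) ¬aσ′)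
      place : σ ≺ τ ⊎ σ ≡ τ → ∃ λ σ → σ ≺ τ × σ accessible × σ ⊵ x
      place (inj₁ σ≺τ)  = σ , σ≺τ , aσ , to (rank-unique aσ (below-e σ≼τ) x) z
      place (inj₂ refl) = ⊥-elim (¬aτ aσ)

    module _ {τ} (τ≺e : τ ≺ e) (¬aτ : ¬ τ accessible) where

      -- diag σ is accessible iff g denies that its rank is at most that of σ.  If g were correct, the accessible
      -- diag σ would thus be cofinal in rank, and accessibility would be Σ¹₁: being dominated by one of them.
      incorrect : ∀ {g} → Σ¹₁ (Graph g) → ¬ (∀ {σ} → σ ≺ τ → σ accessible → ∀ x → Correct g σ x)
      incorrect {g} (k , φ , graph) correct-g = y-not-dominated (dominate ay)
        where
        ud = universal diagonalᶠ φ
        c : ℕ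
        c = proj₁ ud
        -- The argument `π c σ` hands the code c to the formula, which replaces the recursion
        -- theorem.
        diag : ℕ → ℕ
        diag σ = inst c (π c σ)

        diag-inaccessible : ∀ σ → (¬ diag σ accessible) ⇔ Zero g σ (diag σ)
        diag-inaccessible σ = ⇔-trans (proj₂ ud (π c σ)) (mk⇔
          (λ (Z , hs , b , i , sat , satφ) →
            zero-at (to (diagonalᶠ-correct {Z}) sat) (from (graph (i ∷ b ∷ [])) (hs , satφ)))
          (λ z → let hs , satφ = to (graph (π σ (diag σ) ∷ 0 ∷ [])) z in
            (λ _ → 0) , hs , 0 , π σ (diag σ)
            , from (diagonalᶠ-correct {λ _ → 0}) (c , σ , refl , refl , refl) , satφ))
          where
          zero-at : ∀ {i b} → (∃ λ c′ → ∃ λ σ′ → π c σ ≡ π c′ σ′ × i ≡ π σ′ (inst c′ (π c σ)) × b ≡ 0) →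
                    g i ≡ b → Zero g σ (diag σ)
          zero-at (_ , _ , eq , refl , refl) p with refl , refl ← π-injective eq = p

        g-unique : ∀ {σ} → σ accessible → σ ≺ τ → ∀ x → Zero g σ x ⇔ σ ⊵ x
        g-unique aσ σ≺τ = correct-unique (λ σ → σ ≺ τ × σ accessible)
          (λ { (σ≺τ , acc below) σ′≺σ → ≺-trans σ′≺σ σ≺τ , below σ′≺σ })
          {g} (λ (σ≺τ , aσ) → correct-g σ≺τ aσ) aσ (σ≺τ , aσ)

        diag-escapes : ∀ {σ} → σ accessible → σ ≺ τ → ¬ Zero g σ (diag σ)
        diag-escapes {σ} aσ σ≺τ z =
          from (diag-inaccessible σ) z (⊵-accessible aσ (to (g-unique aσ σ≺τ (diag σ)) z))

        um = universal (dominatedᶠ c) φ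
        y : ℕ
        y = inst (proj₁ um) (proj₁ um)

        -- Here σ ranges over all numbers, not only over nodes below τ. As `diag-inaccessible` holds
        -- for each of them, every such `diag σ` is accessible.
        y-inaccessible : (¬ y accessible) ⇔ (∃ λ σ → (¬ Zero g σ (diag σ)) × diag σ ⊵ y)
        y-inaccessible = ⇔-trans (proj₂ um (proj₁ um)) (mk⇔
          (λ (Z , hs , b , i , sat , satφ) →
            unpack {Z} (to (dominatedᶠ-correct {Z} c) sat) (from (graph (i ∷ b ∷ [])) (hs , satφ)))
          (λ (σ , nz , Z , sim , z) →
            let hs , satφ = to (graph (π σ (diag σ) ∷ g (π σ (diag σ)) ∷ [])) refl in
            Z , hs , g (π σ (diag σ)) , π σ (diag σ)
            , from (dominatedᶠ-correct {Z} c) (diag σ , σ , y , c , refl , refl , refl , refl , nz , z , sim) , satφ))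
          where
          unpack : ∀ {Z i b} → Dominated c Z i b (proj₁ um) → g i ≡ b → ∃ λ σ → (¬ Zero g σ (diag σ)) × diag σ ⊵ y
          unpack {Z} (_ , σ , _ , _ , refl , refl , refl , refl , nz , z , sim) refl = σ , nz , Z , sim , z

        ay : y accessible
        ay = decidable-stable em λ ¬ay → let σ , nz , d = to y-inaccessible ¬ay in
          ¬ay (⊵-accessible (decidable-stable em (λ ¬a → nz (to (diag-inaccessible σ) ¬a))) d)

        -- Cofinality gives an accessible σ that dominates y. If σ dominated `diag σ`, then g would
        -- say so; hence by totality `diag σ` dominates σ, and with it y.
        dominate : y accessible → ∃ λ σ → (¬ Zero g σ (diag σ)) × diag σ ⊵ y
        dominate ay with σ , σ≺τ , aσ , σ⊵y ← cofinal ay τ≺e ¬aτ with ⊵-total aσ (diag σ)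
        ... | inj₁ σ⊵d = ⊥-elim (diag-escapes aσ σ≺τ (from (g-unique aσ σ≺τ (diag σ)) σ⊵d))
        ... | inj₂ d⊵σ = σ , diag-escapes aσ σ≺τ , ⊵-trans d⊵σ σ⊵y

        y-not-dominated : ¬ (∃ λ σ → (¬ Zero g σ (diag σ)) × diag σ ⊵ y)
        y-not-dominated p = from y-inaccessible p ay

  -- The functional `G`.

  module _ (e : ℕ) where

    faultᶜ : Core 1
    faultᶜ = bind (constᶜ e) (formula ρ id faultᶠ)
      module faultᶜ where
      ρ : Functions 2
      ρ zero       = ATᶜ
      ρ (suc zero) = orc

    faultᶜ-correct : ∀ g i → True (⟦ faultᶜ ⟧ g (i ∷ [])) ⇔ Fault g e i
    faultᶜ-correct g i = ⇔-trans (formula-correct {hs = AT ∷ g ∷ []} dρ {xs = e ∷ i ∷ []} renames faultᶠ)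
        faultᶠ-correct
      where
      dρ : Denotes faultᶜ.ρ g (AT ∷ g ∷ [])
      dρ zero       x xs = ATᶜ-correct g x xs
      dρ (suc zero) x xs = refl
      renames : Renames id (e ∷ i ∷ []) (⟦ constᶜ e ⟧ g (i ∷ []) ∷ i ∷ [])
      renames zero       = constᶜ-correct e g (i ∷ [])
      renames (suc zero) = refl

    -- The second disjunct makes every number a target when g has no fault, so that the search
    -- always ends.
    targetᶜ : Core 1
    targetᶜ = faultᶜ ∨ᶜ (¬ᶜ wk (ex faultᶜ))

    Target : Tp 1 → ℕ → Set
    Target g i = Fault g e i ⊎ ¬ ∃ (Fault g e)

    targetᶜ-correct : ∀ g i → True (⟦ targetᶜ ⟧ g (i ∷ [])) ⇔ Target g i
    targetᶜ-correct g i = ∨-true (faultᶜ-correct g i) (¬-true (∃-true λ j → faultᶜ-correct g j))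

    target-exists : ∀ g → ∃ (Target g)
    target-exists g with em {∃ (Fault g e)}
    ... | yes (i , p) = i , inj₁ p
    ... | no ¬p       = 0 , inj₂ ¬p

    -- The final S1 lengthens the prefix by one, so that it includes the position m found by the
    -- search.
    bound : ∀ g → ∃ λ m → ⟪ ⟨ 4 ∷ ⟨ 1 ∷ [] ⟩ ∷ search E targetᶜ ∷ [] ⟩ ⟫⟨ (1 , g) ∷ (2 , E) ∷ [] ⟩≃ suc m × Target g m
    bound g = let i , p = target-exists g
                  m , run , z = search-correct E targetᶜ g i (from (targetᶜ-correct g i) p)
              in m , S4 run S1 , to (targetᶜ-correct g m) z

    G : Tp 2
    G g = suc (proj₁ (bound g))

    G-computable : G ComputableIn E
    G-computable = _ , λ g → proj₁ (proj₂ (bound g))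

  -- A binary function that no hyperarithmetical neighbourhood covers.

  restriction : ∀ {f g N} → f ∈[ g ⇂ N ] → ∀ i → i < N → f i ≡ g i
  restriction {f} {g} {N} eq = go f g N (trans (cong (applyUpTo f) (sym (length-applyUpTo g N))) eq)
    where
    go : ∀ f g N → applyUpTo f N ≡ applyUpTo g N → ∀ i → i < N → f i ≡ g i
    go f g (suc N) eq zero    _         = proj₁ (∷-injective eq)
    go f g (suc N) eq (suc i) (s≤s i<N) = go (f ∘ suc) (g ∘ suc) N (proj₂ (∷-injective eq)) i i<N

  module _ (e : ℕ) (¬ae : ¬ e accessible) (H : Tp 1) (ranks : PseudoRank H e) where

    truncated : Tp 1
    truncated i = H i ⊓ 1

    truncated-∈2^ℕ : truncated ∈2^ℕ
    truncated-∈2^ℕ i = s≤s (m⊓n≤n (H i) 1)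

    truncated-zero : ∀ i → truncated i ≡ 0 ⇔ H i ≡ 0
    truncated-zero i with H i
    ... | zero  = mk⇔ id id
    ... | suc _ = mk⇔ (λ ()) (λ ())

    misses : ∀ {g} → Σ¹₁ (Graph g) → ¬ truncated ∈[ g ⇂ G e g ]
    misses {g} Σg f∈ = refute (proj₂ (proj₂ (bound e g)))
      where
      m : ℕ
      m = proj₁ (bound e g)

      refute : ¬ Target e g m
      -- Without faults, induction on accessibility makes g correct at all accessible nodes below e,
      -- which `incorrect` excludes for any inaccessible child of e.
      refute (inj₂ no-fault) =
        let τ , τ≺e , ¬aτ = inaccessible-child ¬ae
        in incorrect e H ranks τ≺e ¬aτ Σg (λ σ≺τ aσ → correct aσ (≺-trans σ≺τ τ≺e))
        where
        correct : ∀ {σ} → σ accessible → σ ≺ e → ∀ x → Correct g σ x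
        correct {σ} (acc below) σ≺e x = decidable-stable em λ wrong → no-fault (π σ x , σ , x , refl , σ≺e , wrong
          , λ σ′ σ′≺σ → correct (below σ′≺σ) (≺-trans σ′≺σ σ≺e))
      refute (inj₁ (σ , x , m≡ , σ≺e , wrong , correct)) with em {σ accessible}
      -- A minimal fault at an inaccessible σ leaves g correct at all nodes below an inaccessible
      -- child of σ, which `incorrect` excludes.
      ... | no ¬aσ = let τ , τ≺σ , ¬aτ = inaccessible-child ¬aσ in
        incorrect e H ranks (≺-trans τ≺σ σ≺e) ¬aτ Σg (λ {σ′} σ′≺τ _ → correct σ′ (≺-trans σ′≺τ τ≺σ))
      ... | yes aσ@(acc below) = wrong
            ( (λ z → to same-below (proj₁ H-correct (to same z)))
            , (λ b → from same (proj₂ H-correct (from same-below b))))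
        where
        H-correct : Correct H σ x
        H-correct = proj₁ ranks σ σ≺e x
        -- This is the only position of the prefix that is used; below σ, both functions are
        -- determined by `_⊵_`.
        same : Zero g σ x ⇔ Zero H σ x
        same = subst (λ v → (v ≡ 0) ⇔ Zero H σ x)
          (restriction {truncated} {g} f∈ (π σ x) (subst (_< G e g) m≡ (n<1+n m))) (truncated-zero (π σ x))
        agree : ∀ {σ′} → σ′ ≺ σ → ∀ x′ → Zero H σ′ x′ ⇔ Zero g σ′ x′
        agree σ′≺σ x′ = mk⇔
          (λ z → from (g-unique x′) (to (rank-unique e H ranks (below σ′≺σ) (≺-trans σ′≺σ σ≺e) x′) z))
          (λ z → from (rank-unique e H ranks (below σ′≺σ) (≺-trans σ′≺σ σ≺e) x′) (to (g-unique x′) z))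
          where
          g-unique = correct-unique (_≺ σ) (λ p q → ≺-trans q p) {g} (λ p → correct _ p) (below σ′≺σ) σ′≺σ
        same-below : Below H σ x ⇔ Below g σ x
        same-below = mk⇔
          (below-map {H} {g} λ σ′≺σ x′ → to (agree σ′≺σ x′))
          (below-map {g} {H} λ σ′≺σ x′ → from (agree σ′≺σ x′))

  -- `G` and `f` are independent of any fan functional. A special fan functional must return for `G`
  -- an entry whose neighbourhood contains `f`, and that entry cannot be hyperarithmetical.
  uncovered : ∃ λ G → G ComputableIn E × ∃ λ f → f ∈2^ℕ × ∀ {g} → Σ¹₁ (Graph g) → ¬ f ∈[ g ⇂ G g ]
  uncovered with e , ¬ae , H , ranks ← pseudo-accessible =
    G e , G-computable e , truncated e ¬ae H ranks , truncated-∈2^ℕ e ¬ae H ranks , misses e ¬ae H ranks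

corollary6p8 : ExcludedMiddle 0ℓ → Extensionality 0ℓ 0ℓ →
    (∃² : Tp 2) → Is∃² ∃² →
    (Θ : Tp 2 → List (Tp 1)) → SFF Θ →
    ∃ λ (G : Tp 2) → G ComputableIn ∃² × ¬ HyperarithmeticalSeq (Θ G)
corollary6p8 em _ ∃² spec Θ sff
  with G , computable , f , f∈2^ℕ , misses ← Construction.uncovered em ∃² spec
  = G , computable , λ hyp → lookupWith {R = λ _ → ⊥} (λ (Σg , _) → misses Σg) hyp (sff G f f∈2^ℕ)
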